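{- Let $D=(E,\mathcal{F})$ be a delta-matroid. Then $D$ has a twist of width one (that is, $w(D*B)=1$ for some $B\subseteq E$) if and only if there is some $A\subseteq E$ such that (1) $A$ is a separator of the matroid $D_{\min}$, (2) $D|A$ is a matroid, and (3) $D|\overline{A}$ is of width one, where $\overline{A}=E-A$.
   Context: A delta-matroid $D=(E,\mathcal{F})$ consists of a finite set $E$ (the ground set) and a non-empty set $\mathcal{F}$ of subsets of $E$ (the feasible sets) satisfying the Symmetric Exchange Axiom: for all $X,Y\in\mathcal{F}$ and every $u\in X\triangle Y$ there is $v\in X\triangle Y$ (possibly $v=u$) with $X\triangle\{u,v\}\in\mathcal{F}$. Here $\triangle$ denotes symmetric difference. A matroid is a delta-matroid whose feasible sets all have the same size; its feasible sets are then its bases. The width of $D$ is $w(D)=\max_{F\in\mathcal{F}}|F|-\min_{F\in\mathcal{F}}|F|$. For $A\subseteq E$, the twist of $D$ with respect to $A$ is the delta-matroid $D*A=(E,\{A\triangle F: F\in\mathcal{F}\})$. A twist of $D$ is any $D*A$ with $A\subseteq E$ (including $A=\emptyset$). $D_{\min}=(E,\mathcal{F}_{\min})$, where $\mathcal{F}_{\min}$ is the set of feasible sets of $D$ of minimum size; it is a matroid. For a matroid $M$ on $E$ with rank function $r$ ($r(X)$ is the size of the largest intersection of $X$ with a basis of $M$), a set $A\subseteq E$ is a separator of $M$ if $A$ is a union of components of $M$; equivalently $r(A)+r(E-A)=r(E)$. Both $\emptyset$ and $E$ are separators. Deletion and contraction: an element $e$ is a coloop of $D$ if it is in every feasible set and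 a loop if it is in no feasible set. If $e$ is not a coloop, $D\setminus e=(E-e,\{F: F\in\mathcal{F}, F\subseteq E-e\})$. If $e$ is not a loop, $D/e=(E-e,\{F-e: F\in\mathcal{F}, e\in F\})$. If $e$ is a loop or coloop, then $D/e=D\setminus e$. The result of a sequence of deletions and contractions does not depend on the order. The restriction $D|A$ is obtained from $D$ by deleting all elements of $E-A$. -}

module Defs where

open import Data.Bool.Base using (if_then_else_; _xor_)
open import Data.Fin.Base using (Fin)
open import Data.Fin.Subset
open import Data.Fin.Subset.Properties
open import Data.List.Base using (allFin; filter; foldl)
open import Data.Nat.Base using (ℕ; _≤_; _∸_)
open import Data.Nat.Properties using (_≤?_)
open import Data.Product.Base using (∃-syntax; _×_; _,_)
open import Data.Sum.Base using (_⊎_)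
open import Data.Vec.Base using (zipWith; here; there; _∷_)
open import Data.Vec.Properties using (≡-dec)
open import Data.Bool.Properties using () renaming (_≟_ to _≟ᵇ_)
open import Function.Base using (_∘_)
open import Function.Bundles using (_⇔_)
open import Relation.Binary.Definitions using (DecidableEquality)
open import Relation.Binary.PropositionalEquality using (_≡_; refl)
open import Relation.Nullary.Decidable using (does; ¬?; _×-dec_; decidable-stable; map′)
open import Relation.Nullary.Negation using (¬_)
open import Relation.Unary using (Pred; Decidable)
open import Level using (0ℓ)

private
  variable
    n : ℕ

infixl 6 _△_
infix  4 _≟ˢ_

_△_ : Subset n → Subset n → Subset n
_△_ = zipWith _xor_

_≟ˢ_ : DecidableEquality (Subset n)
_≟ˢ_ = ≡-dec _≟ᵇ_

x∈p─q⇒x∉q : ∀ {x} (p q : Subset n) → x ∈ p ─ q → x ∉ q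
x∈p─q⇒x∉q (_ ∷ p) (outside ∷ q) (there x∈p─q) (there x∈q) = x∈p─q⇒x∉q p q x∈p─q x∈q
x∈p─q⇒x∉q (_ ∷ p) (inside  ∷ q) (there x∈p─q) (there x∈q) = x∈p─q⇒x∉q p q x∈p─q x∈q

x∉p⇒p⊆q-x : ∀ {x} {p q : Subset n} → x ∉ p → p ⊆ q → p ⊆ q - x
x∉p⇒p⊆q-x x∉p p⊆q y∈p =
  x∈p∧x≢y⇒x∈p-y (p⊆q y∈p) λ { refl → x∉p y∈p }

-- The ground set is an arbitrary subset of Fin n rather than Fin n itself, so
-- that the minors of a set system live over the same n. A set of subsets of a
-- finite set is a decidable predicate on them.
record SetSystem (n : ℕ) : Set₁ where
  field
    ground          : Subset n
    Feasible        : Pred (Subset n) 0ℓ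
    feasible?       : Decidable Feasible
    feasible⊆ground : ∀ {F} → Feasible F → F ⊆ ground

open SetSystem

-- {u , v} is ⁅ u ⁆ ∪ ⁅ v ⁆, which is a singleton when v ≡ u.
record IsDeltaMatroid (D : SetSystem n) : Set where
  field
    nonempty : ∃[ F ] Feasible D F
    exchange : ∀ {X Y} → Feasible D X → Feasible D Y →
               ∀ {u} → u ∈ X △ Y →
               ∃[ v ] (v ∈ X △ Y × Feasible D (X △ (⁅ u ⁆ ∪ ⁅ v ⁆)))

record IsMatroid (D : SetSystem n) : Set where
  field
    isDeltaMatroid : IsDeltaMatroid D
    equicardinal   : ∀ {F F′} → Feasible D F → Feasible D F′ → ∣ F ∣ ≡ ∣ F′ ∣

IsMaxSize : SetSystem n → ℕ → Set
IsMaxSize D k = (∃[ F ] (Feasible D F × ∣ F ∣ ≡ k)) × (∀ {F} → Feasible D F → ∣ F ∣ ≤ k)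

IsMinSize : SetSystem n → ℕ → Set
IsMinSize D k = (∃[ F ] (Feasible D F × ∣ F ∣ ≡ k)) × (∀ {F} → Feasible D F → k ≤ ∣ F ∣)

-- A relation rather than a function, because the maximum and the minimum exist
-- only when there is a feasible set.
HasWidth : SetSystem n → ℕ → Set
HasWidth D w = ∃[ a ] ∃[ b ] (IsMaxSize D a × IsMinSize D b × w ≡ a ∸ b)

△-⊆ : ∀ (p q : Subset n) {r} → p ⊆ r → q ⊆ r → p △ q ⊆ r
△-⊆ (inside  ∷ p) (outside ∷ q)         p⊆r q⊆r here      = p⊆r here
△-⊆ (outside ∷ p) (inside  ∷ q)         p⊆r q⊆r here      = q⊆r here
△-⊆ (_       ∷ p) (_       ∷ q) {_ ∷ r} p⊆r q⊆r (there i) =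
  there (△-⊆ p q (drop-there ∘ p⊆r ∘ there) (drop-there ∘ q⊆r ∘ there) i)

twist : (D : SetSystem n) (A : Subset n) → A ⊆ ground D → SetSystem n
twist D A A⊆E = record
  { ground          = ground D
  ; Feasible        = λ X → ∃[ F ] (Feasible D F × X ≡ A △ F)
  ; feasible?       = λ X → anySubset? λ F → feasible? D F ×-dec (X ≟ˢ A △ F)
  ; feasible⊆ground = λ { (F , f , refl) → △-⊆ A F A⊆E (feasible⊆ground D f) }
  }

minimum : SetSystem n → SetSystem n
minimum D = record
  { ground          = ground D
  ; Feasible        = λ F → Feasible D F × Least F
  ; feasible?       = λ F → feasible? D F ×-dec least? F
  ; feasible⊆ground = λ { (f , _) → feasible⊆ground D f }
  }
  where
  Least : Subset _ → Set
  Least F = ∀ {F′} → Feasible D F′ → ∣ F ∣ ≤ ∣ F′ ∣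

  least? : Decidable Least
  least? F = map′
    (λ none {F′} f′ → decidable-stable (∣ F ∣ ≤? ∣ F′ ∣) λ F≰F′ → none (F′ , f′ , F≰F′))
    (λ least (F′ , f′ , F≰F′) → F≰F′ (least f′))
    (¬? (anySubset? λ F′ → feasible? D F′ ×-dec ¬? (∣ F ∣ ≤? ∣ F′ ∣)))

Coloop : SetSystem n → Pred (Fin n) 0ℓ
Coloop D e = ∀ {F} → Feasible D F → e ∈ F

coloop? : (D : SetSystem n) → Decidable (Coloop D)
coloop? D e = map′
  (λ none {F} f → decidable-stable (e ∈? F) λ e∉F → none (F , f , e∉F))
  (λ coloop (F , f , e∉F) → e∉F (coloop f))
  (¬? (anySubset? λ F → feasible? D F ×-dec ¬? (e ∈? F)))

deleteNonColoop : SetSystem n → Fin n → SetSystem n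
deleteNonColoop D e = record
  { ground          = ground D - e
  ; Feasible        = λ F → Feasible D F × F ⊆ ground D - e
  ; feasible?       = λ F → feasible? D F ×-dec (F ⊆? (ground D - e))
  ; feasible⊆ground = λ { (_ , F⊆E-e) → F⊆E-e }
  }

contractNonLoop : SetSystem n → Fin n → SetSystem n
contractNonLoop D e = record
  { ground          = ground D - e
  ; Feasible        = λ X → ∃[ F ] (Feasible D F × e ∈ F × X ≡ F - e)
  ; feasible?       = λ X → anySubset? λ F →
                        feasible? D F ×-dec ((e ∈? F) ×-dec (X ≟ˢ F - e))
  ; feasible⊆ground = λ { (F , f , _ , refl) →
      x∉p⇒p⊆q-x (λ e∈F-e → x∈p─q⇒x∉q F ⁅ e ⁆ e∈F-e (x∈⁅x⁆ e))
                (feasible⊆ground D f ∘ p─q⊆p F ⁅ e ⁆) }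
  }

-- D ∖ e equals D / e for a coloop e; a coloop of a delta-matroid is never a
-- loop, so D / e is then given by the formula for non-loops.
delete : SetSystem n → Fin n → SetSystem n
delete D e = if does (coloop? D e) then contractNonLoop D e else deleteNonColoop D e

-- D | A. The elements of E ─ A are deleted in increasing order; for a
-- delta-matroid the result does not depend on the order.
restrict : SetSystem n → Subset n → SetSystem n
restrict {n} D A = foldl delete D (filter (_∈? (ground D ─ A)) (allFin n))

Independent : SetSystem n → Pred (Subset n) 0ℓ
Independent M I = ∃[ B ] (Feasible M B × I ⊆ B)

Circuit : SetSystem n → Pred (Subset n) 0ℓ
Circuit M C = C ⊆ ground M × ¬ Independent M C × (∀ {X} → X ⊂ C → Independent M X)

-- The component of e in a matroid is its class under the equivalence relation
-- "equal, or contained in a common circuit" on the ground set.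
Component : SetSystem n → Fin n → Pred (Fin n) 0ℓ
Component M e f = e ∈ ground M × f ∈ ground M ×
                  (e ≡ f ⊎ ∃[ C ] (Circuit M C × e ∈ C × f ∈ C))

-- A is a union of components. As components are equivalence classes, such an A
-- is the union of the components of its own elements.
Separator : SetSystem n → Pred (Subset n) 0ℓ
Separator M A = ∀ f → f ∈ A ⇔ (∃[ e ] (e ∈ A × Component M e f))

-- Write t F = ∣ A △ F ∣. Since t F = ∣ A ∣ + ∣ F ─ A ∣ - ∣ F ∩ A ∣, exchanging the elements
-- of F ∩ A one by one against a feasible set that is minimal on A never makes t
-- smaller. So the maximum of t is attained where F ∩ A is minimal, that is, on the
-- sets giving D | (E ─ A); dually the minimum is attained on those giving D | A.
-- If A is a separator of minimum D, then all the sets of minimum D meet A in equally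
-- many elements, they are minimal both on A and on E ─ A, and it follows that
-- w (D * A) = w (D | A) + w (D | (E ─ A)).
-- Conversely, if D * B has width one, parity forces the sets of minimum D to meet B
-- equally often, so that B is a separator and the two restrictions have widths 0 and 1.
module Submission where

open import Defs
open import Data.Bool.Base using (if_then_else_)
open import Data.Fin.Base using (Fin)
open import Data.Fin.Properties using (_≟_)
open import Data.Fin.Subset
open import Data.Fin.Subset.Properties
open import Data.List.Base using ([]; _∷_; allFin; filter; foldl)
open import Data.List.Membership.Propositional using () renaming (_∈_ to _∈ₗ_)
open import Data.List.Membership.Propositional.Properties using (∈-filter⁺; ∈-filter⁻; ∈-allFin)
open import Data.List.Relation.Unary.Any using (here; there)
open import Data.Nat.Base using (ℕ; suc; _+_; _∸_; _≤_; _<_)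
open import Data.Nat.Induction using (<-wellFounded)
open import Data.Nat.Properties hiding (_≟_)
open import Data.Nat.Tactic.RingSolver using (solve-∀)
open import Data.Product.Base using (_×_; _,_; proj₁; proj₂; ∃-syntax; Σ-syntax)
open import Data.Sum.Base using (_⊎_; inj₁; inj₂; [_,_]′)
open import Data.Vec.Base using ([]; _∷_; here; there; tabulate)
open import Data.Vec.Properties using (lookup∘tabulate; []=⇒lookup; lookup⇒[]=)
open import Function.Base using (_∘_)
open import Function.Bundles using (_⇔_; mk⇔; module Equivalence)
open import Induction.WellFounded using (Acc; acc)
open import Level using (0ℓ)
open import Relation.Binary.PropositionalEquality hiding ([_])
open import Relation.Nullary.Decidable using (dec-true)
open import Relation.Nullary using (Dec; yes; no; does; contradiction; ¬_; ¬?; _×-dec_; decidable-stable)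
open import Relation.Unary using (Pred; Decidable)

open SetSystem
open IsDeltaMatroid
open IsMatroid

private
  variable
    n : ℕ
    D D′ : SetSystem n
    p q G T X Y : Subset n
    x u : Fin n

-- Subsets: membership, sizes and complements.

x∈p─q⁻ : ∀ (p q : Subset n) → x ∈ p ─ q → x ∈ p × x ∉ q
x∈p─q⁻ p q x∈ = p─q⊆p p q x∈ , x∈p─q⇒x∉q p q x∈

x∈p-y⁻ : ∀ (p : Subset n) y → x ∈ p - y → x ∈ p × x ≢ y
x∈p-y⁻ p y x∈ with x∈p , x∉ ← x∈p─q⁻ p ⁅ y ⁆ x∈ = x∈p , x∉⁅y⁆⇒x≢y x∉

x∈p△q⁻ : ∀ (p q : Subset n) → x ∈ p △ q → (x ∈ p × x ∉ q) ⊎ (x ∉ p × x ∈ q)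
x∈p△q⁻ (inside  ∷ _) (outside ∷ _) here = inj₁ (here , λ ())
x∈p△q⁻ (outside ∷ _) (inside  ∷ _) here = inj₂ ((λ ()) , here)
x∈p△q⁻ (_ ∷ p) (_ ∷ q) (there x∈) with x∈p△q⁻ p q x∈
... | inj₁ (x∈p , x∉q) = inj₁ (there x∈p , x∉q ∘ drop-there)
... | inj₂ (x∉p , x∈q) = inj₂ (x∉p ∘ drop-there , there x∈q)

x∈p∧x∉q⇒x∈p△q : x ∈ p → x ∉ q → x ∈ p △ q
x∈p∧x∉q⇒x∈p△q {q = inside  ∷ _} here        x∉q = contradiction here x∉q
x∈p∧x∉q⇒x∈p△q {q = outside ∷ _} here        x∉q = here
x∈p∧x∉q⇒x∈p△q {q = _       ∷ _} (there x∈p) x∉q = there (x∈p∧x∉q⇒x∈p△q x∈p (x∉q ∘ there))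

△-comm : ∀ (p q : Subset n) → p △ q ≡ q △ p
△-comm []            []            = refl
△-comm (inside  ∷ p) (inside  ∷ q) = cong (_ ∷_) (△-comm p q)
△-comm (inside  ∷ p) (outside ∷ q) = cong (_ ∷_) (△-comm p q)
△-comm (outside ∷ p) (inside  ∷ q) = cong (_ ∷_) (△-comm p q)
△-comm (outside ∷ p) (outside ∷ q) = cong (_ ∷_) (△-comm p q)

x∉p∧x∈q⇒x∈p△q : ∀ (p : Subset n) → x ∉ p → x ∈ q → x ∈ p △ q
x∉p∧x∈q⇒x∈p△q {q = q} p x∉p x∈q = subst (_ ∈_) (△-comm q p) (x∈p∧x∉q⇒x∈p△q x∈q x∉p)

△-distribʳ-─ : ∀ (p q r : Subset n) → (p △ q) ─ r ≡ (p ─ r) △ (q ─ r)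
△-distribʳ-─ []      []      []            = refl
△-distribʳ-─ (_ ∷ p) (_ ∷ q) (inside  ∷ r) = cong (_ ∷_) (△-distribʳ-─ p q r)
△-distribʳ-─ (_ ∷ p) (_ ∷ q) (outside ∷ r) = cong (_ ∷_) (△-distribʳ-─ p q r)

∣p∩q∣+∣p─q∣≡∣p∣ : ∀ (p q : Subset n) → ∣ p ∩ q ∣ + ∣ p ─ q ∣ ≡ ∣ p ∣
∣p∩q∣+∣p─q∣≡∣p∣ []            []            = refl
∣p∩q∣+∣p─q∣≡∣p∣ (inside  ∷ p) (inside  ∷ q) = cong suc (∣p∩q∣+∣p─q∣≡∣p∣ p q)
∣p∩q∣+∣p─q∣≡∣p∣ (inside  ∷ p) (outside ∷ q) =
  trans (+-suc ∣ p ∩ q ∣ ∣ p ─ q ∣) (cong suc (∣p∩q∣+∣p─q∣≡∣p∣ p q))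
∣p∩q∣+∣p─q∣≡∣p∣ (outside ∷ p) (inside  ∷ q) = ∣p∩q∣+∣p─q∣≡∣p∣ p q
∣p∩q∣+∣p─q∣≡∣p∣ (outside ∷ p) (outside ∷ q) = ∣p∩q∣+∣p─q∣≡∣p∣ p q

-- Kept additive because subtraction on `ℕ` truncates; sizes in a twist are computed from this
-- identity.
∣p△q∣+∣q∩p∣≡∣p∣+∣q─p∣ : ∀ (p q : Subset n) → ∣ p △ q ∣ + ∣ q ∩ p ∣ ≡ ∣ p ∣ + ∣ q ─ p ∣
∣p△q∣+∣q∩p∣≡∣p∣+∣q─p∣ []            []            = refl
∣p△q∣+∣q∩p∣≡∣p∣+∣q─p∣ (inside  ∷ p) (inside  ∷ q) =
  trans (+-suc ∣ p △ q ∣ ∣ q ∩ p ∣) (cong suc (∣p△q∣+∣q∩p∣≡∣p∣+∣q─p∣ p q))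
∣p△q∣+∣q∩p∣≡∣p∣+∣q─p∣ (inside  ∷ p) (outside ∷ q) = cong suc (∣p△q∣+∣q∩p∣≡∣p∣+∣q─p∣ p q)
∣p△q∣+∣q∩p∣≡∣p∣+∣q─p∣ (outside ∷ p) (inside  ∷ q) =
  trans (cong suc (∣p△q∣+∣q∩p∣≡∣p∣+∣q─p∣ p q)) (sym (+-suc ∣ p ∣ ∣ q ─ p ∣))
∣p△q∣+∣q∩p∣≡∣p∣+∣q─p∣ (outside ∷ p) (outside ∷ q) = ∣p△q∣+∣q∩p∣≡∣p∣+∣q─p∣ p q

∣p∪⁅x⁆∣≤1+∣p∣ : ∀ (p : Subset n) x → ∣ p ∪ ⁅ x ⁆ ∣ ≤ suc ∣ p ∣
∣p∪⁅x⁆∣≤1+∣p∣ p x = begin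
  ∣ p ∪ ⁅ x ⁆ ∣                                  ≡⟨ ∣p∩q∣+∣p─q∣≡∣p∣ (p ∪ ⁅ x ⁆) ⁅ x ⁆ ⟨
  ∣ (p ∪ ⁅ x ⁆) ∩ ⁅ x ⁆ ∣ + ∣ (p ∪ ⁅ x ⁆) - x ∣
    ≤⟨ +-mono-≤ (∣p∩q∣≤∣q∣ (p ∪ ⁅ x ⁆) ⁅ x ⁆) (p⊆q⇒∣p∣≤∣q∣ back) ⟩
  ∣ ⁅ x ⁆ ∣ + ∣ p ∣                              ≡⟨ cong (_+ ∣ p ∣) (∣⁅x⁆∣≡1 x) ⟩
  suc ∣ p ∣                                      ∎
  where
  open ≤-Reasoning
  back : (p ∪ ⁅ x ⁆) - x ⊆ p
  back y∈ with y∈∪ , y∉ ← x∈p─q⁻ (p ∪ ⁅ x ⁆) ⁅ x ⁆ y∈ with x∈p∪q⁻ p ⁅ x ⁆ y∈∪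
  ... | inj₁ y∈p = y∈p
  ... | inj₂ y∈x = contradiction y∈x y∉

∣p-u∪⁅v⁆∣≤∣p∣ : ∀ {v} → u ∈ p → ∣ (p - u) ∪ ⁅ v ⁆ ∣ ≤ ∣ p ∣
∣p-u∪⁅v⁆∣≤∣p∣ {p = p} u∈p = ≤-trans (∣p∪⁅x⁆∣≤1+∣p∣ (p - _) _) (x∈p⇒∣p-x∣<∣p∣ u∈p)

x∉p⇒∣p∣<∣p∪⁅x⁆∣ : ∀ (p : Subset n) → x ∉ p → ∣ p ∣ < ∣ p ∪ ⁅ x ⁆ ∣
x∉p⇒∣p∣<∣p∪⁅x⁆∣ {x = x} p x∉p =
  p⊂q⇒∣p∣<∣q∣ (p⊆p∪q ⁅ x ⁆ , x , q⊆p∪q p ⁅ x ⁆ (x∈⁅x⁆ x) , x∉p)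

p⊈q⇒Nonempty[p─q] : ∀ (p q : Subset n) → p ⊈ q → Nonempty (p ─ q)
p⊈q⇒Nonempty[p─q] p q p⊈q = decidable-stable (nonempty? (p ─ q)) λ empty →
  p⊈q λ {x} x∈p → decidable-stable (x ∈? q) λ x∉q → empty (x , x∈p∧x∉q⇒x∈p─q x∈p x∉q)

p⊆q∧∣q∣≤∣p∣⇒p≡q : p ⊆ q → ∣ q ∣ ≤ ∣ p ∣ → p ≡ q
p⊆q∧∣q∣≤∣p∣⇒p≡q {p = p} {q = q} p⊆q ∣q∣≤∣p∣ = ⊆-antisym p⊆q
  (decidable-stable (q ⊆? p) λ q⊈p →
    let x , x∈ = p⊈q⇒Nonempty[p─q] q p q⊈p in
    <⇒≱ (p⊂q⇒∣p∣<∣q∣ (p⊆q , x , x∈p─q⁻ q p x∈)) ∣q∣≤∣p∣)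

∩-monoˡ-⊆ : ∀ (r : Subset n) → p ⊆ q → p ∩ r ⊆ q ∩ r
∩-monoˡ-⊆ {p = p} r p⊆q x∈ with x∈p , x∈r ← x∈p∩q⁻ p r x∈ = x∈p∩q⁺ (p⊆q x∈p , x∈r)

module _ {E F : Subset n} (A : Subset n) (F⊆E : F ⊆ E) where

  p∩[E─A]≡p─A : F ∩ (E ─ A) ≡ F ─ A
  p∩[E─A]≡p─A = ⊆-antisym to from
    where
    to : F ∩ (E ─ A) ⊆ F ─ A
    to x∈ with x∈F , x∈E─A ← x∈p∩q⁻ F (E ─ A) x∈ = x∈p∧x∉q⇒x∈p─q x∈F (x∈p─q⇒x∉q E A x∈E─A)
    from : F ─ A ⊆ F ∩ (E ─ A)
    from x∈ with x∈F , x∉A ← x∈p─q⁻ F A x∈ = x∈p∩q⁺ (x∈F , x∈p∧x∉q⇒x∈p─q (F⊆E x∈F) x∉A)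

  p─[E─A]≡p∩A : F ─ (E ─ A) ≡ F ∩ A
  p─[E─A]≡p∩A = ⊆-antisym to from
    where
    to : F ─ (E ─ A) ⊆ F ∩ A
    to {x} x∈ with x∈F , x∉E─A ← x∈p─q⁻ F (E ─ A) x∈ =
      x∈p∩q⁺ (x∈F , decidable-stable (x ∈? A) λ x∉A → x∉E─A (x∈p∧x∉q⇒x∈p─q (F⊆E x∈F) x∉A))
    from : F ∩ A ⊆ F ─ (E ─ A)
    from x∈ with x∈F , x∈A ← x∈p∩q⁻ F A x∈ =
      x∈p∧x∉q⇒x∈p─q x∈F λ x∈E─A → x∈p─q⇒x∉q E A x∈E─A x∈A

E─[E─A]≡A : ∀ {E A : Subset n} → A ⊆ E → E ─ (E ─ A) ≡ A
E─[E─A]≡A {E = E} {A} A⊆E = trans (p─[E─A]≡p∩A A (λ x∈E → x∈E))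
  (⊆-antisym (p∩q⊆q E A) λ x∈A → x∈p∩q⁺ (A⊆E x∈A , x∈A))

-- `(E ─ A) △ F` is the complement of `A △ F` in `E`. So twisting by `E ─ A` in place of `A`
-- reverses the order of sizes and turns maxima into minima.
∣[E─A]△F∣+∣A△F∣≡∣E∣ : ∀ {E A F : Subset n} → A ⊆ E → F ⊆ E → ∣ (E ─ A) △ F ∣ + ∣ A △ F ∣ ≡ ∣ E ∣
∣[E─A]△F∣+∣A△F∣≡∣E∣ {E = E} {A} {F} A⊆E F⊆E = +-cancelʳ-≡ (∣ F ─ A ∣ + ∣ F ∩ A ∣) _ _ (begin
  t′ + t + (b + a)                             ≡⟨ shuffle₁ t′ t b a ⟩
  (t′ + b) + (t + a)
    ≡⟨ cong₂ _+_ (cong (λ s → t′ + ∣ s ∣) (sym (p∩[E─A]≡p─A A F⊆E))) (∣p△q∣+∣q∩p∣≡∣p∣+∣q─p∣ A F) ⟩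
  (t′ + ∣ F ∩ (E ─ A) ∣) + (∣ A ∣ + b)
    ≡⟨ cong (_+ (∣ A ∣ + b)) (∣p△q∣+∣q∩p∣≡∣p∣+∣q─p∣ (E ─ A) F) ⟩
  (∣ E ─ A ∣ + ∣ F ─ (E ─ A) ∣) + (∣ A ∣ + b)
    ≡⟨ cong (λ s → (∣ E ─ A ∣ + ∣ s ∣) + (∣ A ∣ + b)) (p─[E─A]≡p∩A A F⊆E) ⟩
  (∣ E ─ A ∣ + a) + (∣ A ∣ + b)                ≡⟨ shuffle₂ (∣ E ─ A ∣) a (∣ A ∣) b ⟩
  ∣ A ∣ + ∣ E ─ A ∣ + (b + a)                  ≡⟨ cong (λ s → ∣ s ∣ + ∣ E ─ A ∣ + (b + a)) A≡E∩A ⟩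
  ∣ E ∩ A ∣ + ∣ E ─ A ∣ + (b + a)              ≡⟨ cong (_+ (b + a)) (∣p∩q∣+∣p─q∣≡∣p∣ E A) ⟩
  ∣ E ∣ + (b + a)                              ∎)
  where
  open ≡-Reasoning
  t′ = ∣ (E ─ A) △ F ∣
  t  = ∣ A △ F ∣
  a  = ∣ F ∩ A ∣
  b  = ∣ F ─ A ∣
  A≡E∩A : A ≡ E ∩ A
  A≡E∩A = ⊆-antisym (λ x∈A → x∈p∩q⁺ (A⊆E x∈A , x∈A)) (p∩q⊆q E A)
  shuffle₁ : ∀ t′ t b a → t′ + t + (b + a) ≡ (t′ + b) + (t + a)
  shuffle₁ = solve-∀
  shuffle₂ : ∀ c a d b → (c + a) + (d + b) ≡ d + c + (b + a)
  shuffle₂ = solve-∀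

module _ {P : Pred (Fin n) 0ℓ} (P? : Decidable P) where

  comprehension : Subset n
  comprehension = tabulate (does ∘ P?)

  ∈-comprehension⁺ : P x → x ∈ comprehension
  ∈-comprehension⁺ {x} px = lookup⇒[]= x _ (trans (lookup∘tabulate _ x) (dec-true (P? x) px))

  ∈-comprehension⁻ : x ∈ comprehension → P x
  ∈-comprehension⁻ {x} x∈ with P? x | trans (sym (lookup∘tabulate (does ∘ P?) x)) ([]=⇒lookup x∈)
  ... | yes px | _ = px

-- Symmetric exchange and its effect on sizes in a twist.

-- The element v given by the exchange axiom for u ∈ X ─ Y lies in X (and may be u)
-- in the first case, and in Y ─ X in the second.
data Exchanged (X Y : Subset n) (u : Fin n) (X′ : Subset n) : Set where
  shrink : ∀ v → X′ ⊆ X - u → X - u ⊆ X′ ∪ ⁅ v ⁆ → Exchanged X Y u X′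
  swap   : ∀ v → v ∈ Y → X′ ⊆ (X - u) ∪ ⁅ v ⁆ → X - u ⊆ X′ → Exchanged X Y u X′

exchange-─ : IsDeltaMatroid D → Feasible D X → Feasible D Y → u ∈ X → u ∉ Y →
             ∃[ X′ ] (Feasible D X′ × Exchanged X Y u X′)
exchange-─ {X = X} {Y = Y} {u = u} isΔ x y u∈X u∉Y = X′ , proj₂ (proj₂ step) , exchanged
  where
  step = exchange isΔ x y (x∈p∧x∉q⇒x∈p△q u∈X u∉Y)
  v = proj₁ step
  K = ⁅ u ⁆ ∪ ⁅ v ⁆
  X′ = X △ K

  old-or-new : ∀ {x} → x ∈ X′ → x ∈ X - u ⊎ (x ≡ v × v ∉ X)
  old-or-new x∈X′ with x∈p△q⁻ X K x∈X′
  ... | inj₁ (x∈X , x∉K) = inj₁ (x∈p∧x≢y⇒x∈p-y x∈X λ { refl → x∉K (p⊆p∪q _ (x∈⁅x⁆ u)) })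
  ... | inj₂ (x∉X , x∈K) with x∈p∪q⁻ ⁅ u ⁆ ⁅ v ⁆ x∈K
  ...   | inj₁ x∈u with refl ← x∈⁅y⁆⇒x≡y u x∈u = contradiction u∈X x∉X
  ...   | inj₂ x∈v with refl ← x∈⁅y⁆⇒x≡y v x∈v = inj₂ (refl , x∉X)

  kept : ∀ {x} → x ∈ X - u → x ≢ v → x ∈ X′
  kept x∈ x≢v with x∈X , x≢u ← x∈p-y⁻ X u x∈ = x∈p∧x∉q⇒x∈p△q x∈X λ x∈K →
    [ x≢u ∘ x∈⁅y⁆⇒x≡y u , x≢v ∘ x∈⁅y⁆⇒x≡y v ]′ (x∈p∪q⁻ ⁅ u ⁆ ⁅ v ⁆ x∈K)

  exchanged : Exchanged X Y u X′
  exchanged with x∈p△q⁻ X Y (proj₁ (proj₂ step))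
  ... | inj₁ (v∈X , _) = shrink v
    (λ x∈ → [ (λ x∈X-u → x∈X-u) , (λ { (_ , v∉X) → contradiction v∈X v∉X }) ]′ (old-or-new x∈))
    λ {x} x∈ → x∈p∪q⁺ (keep x x∈)
    where
    keep : ∀ x → x ∈ X - u → x ∈ X′ ⊎ x ∈ ⁅ v ⁆
    keep x x∈ with x ≟ v
    ... | yes refl = inj₂ (x∈⁅x⁆ v)
    ... | no x≢v   = inj₁ (kept x∈ x≢v)
  ... | inj₂ (v∉X , v∈Y) = swap v v∈Y
    (λ x∈ → x∈p∪q⁺ ([ inj₁ , (λ { (refl , _) → inj₂ (x∈⁅x⁆ v) }) ]′ (old-or-new x∈)))
    λ x∈ → kept x∈ λ { refl → v∉X (proj₁ (x∈p-y⁻ X u x∈)) }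

exchanged-⊆ : ∀ {X′} → Exchanged X Y u X′ → X′ ⊆ (X - u) ∪ Y
exchanged-⊆ {Y = Y} (shrink v X′⊆ _) x∈ = p⊆p∪q Y (X′⊆ x∈)
exchanged-⊆ {X = X} {Y = Y} {u = u} (swap v v∈Y X′⊆ _) x∈ with x∈p∪q⁻ (X - u) ⁅ v ⁆ (X′⊆ x∈)
... | inj₁ x∈X-u = p⊆p∪q Y x∈X-u
... | inj₂ x∈v with refl ← x∈⁅y⁆⇒x≡y v x∈v = q⊆p∪q (X - u) Y v∈Y

-- What enters `X′` comes from `Y ⊆ S`, while `u ∉ S` leaves. This is the decreasing measure when
-- `X` is exchanged into `S`.
exchanged-─ : ∀ {X′ S} → Exchanged X Y u X′ → u ∈ X → u ∉ S → Y ⊆ S → ∣ X′ ─ S ∣ < ∣ X ─ S ∣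
exchanged-─ {X = X} {Y} {u} {X′} {S} ex u∈X u∉S Y⊆S = p⊂q⇒∣p∣<∣q∣
  (proj₁ ∘ old , u , x∈p∧x∉q⇒x∈p─q u∈X u∉S , λ u∈ → proj₂ (old u∈) refl)
  where
  old : ∀ {x} → x ∈ X′ ─ S → x ∈ X ─ S × x ≢ u
  old x∈ with x∈X′ , x∉S ← x∈p─q⁻ X′ S x∈ with x∈p∪q⁻ (X - u) Y (exchanged-⊆ ex x∈X′)
  ... | inj₁ x∈X-u with x∈X , x≢u ← x∈p-y⁻ X u x∈X-u = x∈p∧x∉q⇒x∈p─q x∈X x∉S , x≢u
  ... | inj₂ x∈Y = contradiction (Y⊆S x∈Y) x∉S

-- ∣ T △ X ∣ = ∣ T ∣ + ∣ X ─ T ∣ - ∣ X ∩ T ∣, so sizes in the twist by T compare as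
-- these differences do.
∣T△X∣≤∣T△Y∣ : ∀ (T X Y : Subset n) →
              ∣ X ─ T ∣ + ∣ Y ∩ T ∣ ≤ ∣ Y ─ T ∣ + ∣ X ∩ T ∣ → ∣ T △ X ∣ ≤ ∣ T △ Y ∣
∣T△X∣≤∣T△Y∣ T X Y le = +-cancelʳ-≤ (∣ X ∩ T ∣ + ∣ Y ∩ T ∣) _ _ (begin
  ∣ T △ X ∣ + (∣ X ∩ T ∣ + ∣ Y ∩ T ∣)  ≡⟨ +-assoc ∣ T △ X ∣ _ _ ⟨
  ∣ T △ X ∣ + ∣ X ∩ T ∣ + ∣ Y ∩ T ∣    ≡⟨ cong (_+ ∣ Y ∩ T ∣) (∣p△q∣+∣q∩p∣≡∣p∣+∣q─p∣ T X) ⟩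
  ∣ T ∣ + ∣ X ─ T ∣ + ∣ Y ∩ T ∣        ≡⟨ +-assoc ∣ T ∣ _ _ ⟩
  ∣ T ∣ + (∣ X ─ T ∣ + ∣ Y ∩ T ∣)      ≤⟨ +-monoʳ-≤ ∣ T ∣ le ⟩
  ∣ T ∣ + (∣ Y ─ T ∣ + ∣ X ∩ T ∣)      ≡⟨ +-assoc ∣ T ∣ _ _ ⟨
  ∣ T ∣ + ∣ Y ─ T ∣ + ∣ X ∩ T ∣        ≡⟨ cong (_+ ∣ X ∩ T ∣) (∣p△q∣+∣q∩p∣≡∣p∣+∣q─p∣ T Y) ⟨
  ∣ T △ Y ∣ + ∣ Y ∩ T ∣ + ∣ X ∩ T ∣    ≡⟨ +-assoc ∣ T △ Y ∣ _ _ ⟩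
  ∣ T △ Y ∣ + (∣ Y ∩ T ∣ + ∣ X ∩ T ∣)  ≡⟨ cong (∣ T △ Y ∣ +_) (+-comm ∣ Y ∩ T ∣ _) ⟩
  ∣ T △ Y ∣ + (∣ X ∩ T ∣ + ∣ Y ∩ T ∣)  ∎)
  where open ≤-Reasoning

-- Losing `u ∈ T` raises the size in the twist by one, and `v`, when distinct from `u`, changes it
-- by at most one.
exchanged-△ : ∀ {X′ T} → Exchanged X Y u X′ → u ∈ X → u ∈ T → ∣ T △ X ∣ ≤ ∣ T △ X′ ∣
exchanged-△ {X = X} {Y} {u} {X′} {T} ex u∈X u∈T = ∣T△X∣≤∣T△Y∣ T X X′ (gain ex)
  where
  u∈X∩T : u ∈ X ∩ T
  u∈X∩T = x∈p∩q⁺ (u∈X , u∈T)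
  X─T⊆X-u : X ─ T ⊆ X - u
  X─T⊆X-u x∈ with x∈X , x∉T ← x∈p─q⁻ X T x∈ = x∈p∧x≢y⇒x∈p-y x∈X λ { refl → x∉T u∈T }
  gain : Exchanged X Y u X′ → ∣ X ─ T ∣ + ∣ X′ ∩ T ∣ ≤ ∣ X′ ─ T ∣ + ∣ X ∩ T ∣
  gain (shrink v X′⊆ ⊆X′) = begin
    ∣ X ─ T ∣ + ∣ X′ ∩ T ∣
      ≤⟨ +-monoˡ-≤ _ (≤-trans (p⊆q⇒∣p∣≤∣q∣ outer) (∣p∪⁅x⁆∣≤1+∣p∣ (X′ ─ T) v)) ⟩
    suc (∣ X′ ─ T ∣ + ∣ X′ ∩ T ∣)  ≡⟨ +-suc _ _ ⟨
    ∣ X′ ─ T ∣ + suc ∣ X′ ∩ T ∣    ≤⟨ +-monoʳ-≤ _ (p⊂q⇒∣p∣<∣q∣ inner) ⟩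
    ∣ X′ ─ T ∣ + ∣ X ∩ T ∣         ∎
    where
    open ≤-Reasoning
    outer : X ─ T ⊆ (X′ ─ T) ∪ ⁅ v ⁆
    outer x∈ = x∈p∪q⁺ ([ (λ x∈X′ → inj₁ (x∈p∧x∉q⇒x∈p─q x∈X′ (x∈p─q⇒x∉q X T x∈))) , inj₂ ]′
                         (x∈p∪q⁻ X′ ⁅ v ⁆ (⊆X′ (X─T⊆X-u x∈))))
    inner : X′ ∩ T ⊂ X ∩ T
    inner = ∩-monoˡ-⊆ T (proj₁ ∘ x∈p-y⁻ X u ∘ X′⊆)
          , u , u∈X∩T , λ u∈ → proj₂ (x∈p-y⁻ X u (X′⊆ (p∩q⊆p X′ T u∈))) refl
  gain (swap v _ X′⊆ ⊆X′) = +-mono-≤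
    (p⊆q⇒∣p∣≤∣q∣ λ x∈ → x∈p∧x∉q⇒x∈p─q (⊆X′ (X─T⊆X-u x∈)) (x∈p─q⇒x∉q X T x∈))
    (≤-trans (p⊆q⇒∣p∣≤∣q∣ inner) (∣p-u∪⁅v⁆∣≤∣p∣ u∈X∩T))
    where
    inner : X′ ∩ T ⊆ ((X ∩ T) - u) ∪ ⁅ v ⁆
    inner x∈ with x∈X′ , x∈T ← x∈p∩q⁻ X′ T x∈ with x∈p∪q⁻ (X - u) ⁅ v ⁆ (X′⊆ x∈X′)
    ... | inj₂ x∈v = q⊆p∪q ((X ∩ T) - u) ⁅ v ⁆ x∈v
    ... | inj₁ x∈X-u with x∈X , x≢u ← x∈p-y⁻ X u x∈X-u =
      p⊆p∪q ⁅ v ⁆ (x∈p∧x≢y⇒x∈p-y (x∈p∩q⁺ (x∈X , x∈T)) x≢u)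

-- Elements of `X ∩ T` outside `G` are exchanged against `G` one at a time, and no step lowers the
-- size in the twist. So the maximal twisted size is reached by a set whose trace on `T` lies in
-- `G`.
grow-△ : IsDeltaMatroid D → ∀ T → Feasible D G → Feasible D X →
         ∃[ X′ ] (Feasible D X′ × X′ ∩ T ⊆ G × ∣ T △ X ∣ ≤ ∣ T △ X′ ∣)
grow-△ {D = D} {G} isΔ T g x = go _ x (<-wellFounded _)
  where
  -- Then `X ─ S` is the part of `X ∩ T` outside `G`, and `G ⊆ S` as the descent requires.
  S = G ∪ ∁ T
  go : ∀ X → Feasible D X → Acc _<_ ∣ X ─ S ∣ →
       ∃[ X′ ] (Feasible D X′ × X′ ∩ T ⊆ G × ∣ T △ X ∣ ≤ ∣ T △ X′ ∣)
  go X x (acc rec) with nonempty? (X ─ S)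
  ... | no empty = X , x , X∩T⊆G , ≤-refl
    where
    X∩T⊆G : X ∩ T ⊆ G
    X∩T⊆G {z} z∈ with z∈X , z∈T ← x∈p∩q⁻ X T z∈ = decidable-stable (z ∈? G) λ z∉G →
      empty (z , x∈p∧x∉q⇒x∈p─q z∈X ([ z∉G , x∈p⇒x∉∁p z∈T ]′ ∘ x∈p∪q⁻ G (∁ T)))
  ... | yes (u , u∈) =
    let u∈X , u∉S = x∈p─q⁻ X S u∈
        u∈T = x∉∁p⇒x∈p (u∉S ∘ q⊆p∪q G (∁ T))
        X′ , x′ , ex = exchange-─ isΔ x g u∈X (u∉S ∘ p⊆p∪q (∁ T))
        X″ , x″ , X″⊆ , le = go X′ x′ (rec (exchanged-─ ex u∈X u∉S (p⊆p∪q (∁ T))))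
    in X″ , x″ , X″⊆ , ≤-trans (exchanged-△ ex u∈X u∈T) le

-- Basis exchange in `minimum D`.

minimum-nonempty : IsDeltaMatroid D → ∃[ X ] Feasible (minimum D) X
minimum-nonempty {D = D} isΔ with F , f ← nonempty isΔ = go F f (<-wellFounded _)
  where
  go : ∀ F → Feasible D F → Acc _<_ ∣ F ∣ → ∃[ X ] Feasible (minimum D) X
  go F f (acc rec) with anySubset? (λ F′ → feasible? D F′ ×-dec (∣ F′ ∣ <? ∣ F ∣))
  ... | yes (F′ , f′ , lt) = go F′ f′ (rec lt)
  ... | no none = F , f , λ f′ → ≮⇒≥ λ lt → none (_ , f′ , lt)

minimum-resp-≤ : Feasible (minimum D) X → Feasible D Y → ∣ Y ∣ ≤ ∣ X ∣ → Feasible (minimum D) Y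
minimum-resp-≤ (_ , least) y le = y , λ f → ≤-trans le (least f)

-- The shrinking case would give a feasible set smaller than `X`. A swap does not increase the size,
-- so its result is again in `minimum D`: basis exchange against any feasible set `Y` of `D`.
minimum-exchange-─ : IsDeltaMatroid D → Feasible (minimum D) X → Feasible D Y → u ∈ X → u ∉ Y →
                     ∃[ X′ ] (Feasible (minimum D) X′ × X - u ⊆ X′ × Exchanged X Y u X′)
minimum-exchange-─ {D = D} {X = X} isΔ (x , least) y u∈X u∉Y with exchange-─ isΔ x y u∈X u∉Y
... | X′ , x′ , shrink v X′⊆ _ =
  contradiction (least x′) (<⇒≱ (≤-<-trans (p⊆q⇒∣p∣≤∣q∣ X′⊆) (x∈p⇒∣p-x∣<∣p∣ u∈X)))
... | X′ , x′ , ex@(swap v v∈Y X′⊆ ⊆X′) =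
  X′ , minimum-resp-≤ {D = D} {X = X} (x , least) x′
         (≤-trans (p⊆q⇒∣p∣≤∣q∣ X′⊆) (∣p-u∪⁅v⁆∣≤∣p∣ u∈X))
     , ⊆X′ , ex

-- Each exchanged `u` lies outside `S`, hence outside `I`, and its replacement comes from `Y ⊆ S`.
-- This plays the role of extending an independent set to a basis.
minimum-extend : ∀ {I S} → IsDeltaMatroid D → Feasible (minimum D) X → Feasible D Y →
                 I ⊆ X → I ⊆ S → Y ⊆ S → ∃[ X′ ] (Feasible (minimum D) X′ × I ⊆ X′ × X′ ⊆ S)
minimum-extend {D = D} {I = I} {S} isΔ x y I⊆X I⊆S Y⊆S = go _ x I⊆X (<-wellFounded _)
  where
  go : ∀ X → Feasible (minimum D) X → I ⊆ X → Acc _<_ ∣ X ─ S ∣ →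
       ∃[ X′ ] (Feasible (minimum D) X′ × I ⊆ X′ × X′ ⊆ S)
  go X x I⊆X (acc rec) with X ⊆? S
  ... | yes X⊆S = X , x , I⊆X , X⊆S
  ... | no X⊈S =
    let u , u∈ = p⊈q⇒Nonempty[p─q] X S X⊈S
        u∈X , u∉S = x∈p─q⁻ X S u∈
        X′ , x′ , ⊆X′ , ex = minimum-exchange-─ {D = D} isΔ x y u∈X (u∉S ∘ Y⊆S)
    in go X′ x′ (λ i∈I → ⊆X′ (x∈p∧x≢y⇒x∈p-y (I⊆X i∈I) λ { refl → u∉S (I⊆S i∈I) }))
          (rec (exchanged-─ ex u∈X u∉S Y⊆S))

minimum-∣∣ : Feasible (minimum D) X → Feasible (minimum D) Y → ∣ X ∣ ≡ ∣ Y ∣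
minimum-∣∣ (x , x-least) (y , y-least) = ≤-antisym (x-least y) (y-least x)

∣q─[p-e∪⁅f⁆]∣<∣q─p∣ : ∀ {e f} → f ∈ q → f ∉ p → e ∉ q → ∣ q ─ ((p - e) ∪ ⁅ f ⁆) ∣ < ∣ q ─ p ∣
∣q─[p-e∪⁅f⁆]∣<∣q─p∣ {q = q} {p = p} {e} {f} f∈q f∉p e∉q = p⊂q⇒∣p∣<∣q∣
  (sub , f , x∈p∧x∉q⇒x∈p─q f∈q f∉p , λ f∈ → x∈p─q⇒x∉q q r f∈ (q⊆p∪q (p - e) ⁅ f ⁆ (x∈⁅x⁆ f)))
  where
  r = (p - e) ∪ ⁅ f ⁆
  sub : q ─ r ⊆ q ─ p
  sub x∈ with x∈q , x∉r ← x∈p─q⁻ q r x∈ = x∈p∧x∉q⇒x∈p─q x∈q λ x∈p →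
    x∉r (p⊆p∪q ⁅ f ⁆ (x∈p∧x≢y⇒x∈p-y x∈p λ { refl → e∉q x∈q }))

-- The intersection could grow only by gaining `f` without losing `e`.
∣[p-e∪⁅f⁆]∩q∣≤∣p∩q∣ : ∀ {e f} → e ∈ p → (f ∈ q → e ∈ q) → ∣ ((p - e) ∪ ⁅ f ⁆) ∩ q ∣ ≤ ∣ p ∩ q ∣
∣[p-e∪⁅f⁆]∩q∣≤∣p∩q∣ {p = p} {q = q} {e} {f} e∈p f∈q⇒e∈q with f ∈? q
... | yes f∈q = ≤-trans (p⊆q⇒∣p∣≤∣q∣ sub) (∣p-u∪⁅v⁆∣≤∣p∣ (x∈p∩q⁺ (e∈p , f∈q⇒e∈q f∈q)))
  where
  sub : ((p - e) ∪ ⁅ f ⁆) ∩ q ⊆ ((p ∩ q) - e) ∪ ⁅ f ⁆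
  sub x∈ with x∈r , x∈q ← x∈p∩q⁻ _ q x∈ with x∈p∪q⁻ (p - e) ⁅ f ⁆ x∈r
  ... | inj₂ x∈f = q⊆p∪q ((p ∩ q) - e) ⁅ f ⁆ x∈f
  ... | inj₁ x∈p-e with x∈p , x≢e ← x∈p-y⁻ p e x∈p-e =
    p⊆p∪q ⁅ f ⁆ (x∈p∧x≢y⇒x∈p-y (x∈p∩q⁺ (x∈p , x∈q)) x≢e)
... | no f∉q = p⊆q⇒∣p∣≤∣q∣ sub
  where
  sub : ((p - e) ∪ ⁅ f ⁆) ∩ q ⊆ p ∩ q
  sub x∈ with x∈r , x∈q ← x∈p∩q⁻ _ q x∈ with x∈p∪q⁻ (p - e) ⁅ f ⁆ x∈r
  ... | inj₂ x∈f = contradiction (subst (_∈ q) (x∈⁅y⁆⇒x≡y f x∈f) x∈q) f∉q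
  ... | inj₁ x∈p-e = x∈p∩q⁺ (proj₁ (x∈p-y⁻ p e x∈p-e) , x∈q)

-- Separators of `minimum D` and the intersections of its bases with them.

module _ (D : SetSystem n) (isΔ : IsDeltaMatroid D) where

  private M = minimum D

  -- For `A ⊆ E` and the rank function `r`, the largest `∣ X ∩ A ∣` is `r(A)` and the smallest is
  -- `r(E) - r(E ─ A)`, so this is the rank condition `r(A) + r(E ─ A) = r(E)`.
  ConstantOn : Subset n → Set
  ConstantOn A = ∀ {X Y} → Feasible M X → Feasible M Y → ∣ X ∩ A ∣ ≡ ∣ Y ∩ A ∣

  -- If a circuit C met A in e and its complement in f, then extending C - e
  -- inside B ∪ C, where B is a basis containing C - f, would give a basis
  -- meeting A in fewer elements than B.
  constant⇒separator : ∀ {A} → A ⊆ ground D → ConstantOn A → Separator M A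
  constant⇒separator {A} A⊆E const f = mk⇔ (λ f∈A → f , f∈A , A⊆E f∈A , A⊆E f∈A , inj₁ refl) from
    where
    from : ∃[ e ] (e ∈ A × Component M e f) → f ∈ A
    from (e , e∈A , _ , _ , inj₁ refl) = e∈A
    from (e , e∈A , _ , _ , inj₂ (C , (_ , C-dep , proper) , e∈C , f∈C)) =
      decidable-stable (f ∈? A) λ f∉A →
        let B₁ , b₁ , C-f⊆B₁ = proper (x∈p⇒p-x⊂p f∈C)
            B₂ , b₂ , C-e⊆B₂ = proper (x∈p⇒p-x⊂p e∈C)
            B , b , C-e⊆B , B⊆ = minimum-extend {D = D} isΔ b₂ (proj₁ b₁) C-e⊆B₂
                                   (q⊆p∪q B₁ (C - e)) (p⊆p∪q (C - e))
            e∉B : e ∉ B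
            e∉B e∈B = C-dep (B , b , λ {x} x∈C → case-≟ x∈C e∈B C-e⊆B)
            e∈B₁ : e ∈ B₁
            e∈B₁ = C-f⊆B₁ (x∈p∧x≢y⇒x∈p-y e∈C λ { refl → f∉A e∈A })
            B∩A⊆B₁∩A : B ∩ A ⊆ B₁ ∩ A
            B∩A⊆B₁∩A x∈ = let x∈B , x∈A = x∈p∩q⁻ B A x∈ in
              x∈p∩q⁺ ([ (λ x∈B₁ → x∈B₁)
                      , (λ x∈C-e → C-f⊆B₁ (x∈p∧x≢y⇒x∈p-y (p─q⊆p C _ x∈C-e) λ { refl → f∉A x∈A }))
                      ]′ (x∈p∪q⁻ B₁ (C - e) (B⊆ x∈B)) , x∈A)
        in <⇒≢ (p⊂q⇒∣p∣<∣q∣ (B∩A⊆B₁∩A , e , x∈p∩q⁺ (e∈B₁ , e∈A) , e∉B ∘ p∩q⊆p B A)) (const b b₁)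
      where
      case-≟ : ∀ {x B} → x ∈ C → e ∈ B → C - e ⊆ B → x ∈ B
      case-≟ {x} x∈C e∈B C-e⊆B with x ≟ e
      ... | yes refl = e∈B
      ... | no x≢e   = C-e⊆B (x∈p∧x≢y⇒x∈p-y x∈C x≢e)

  -- Built from replaceability, which is decidable, rather than as the unique circuit in
  -- `B ∪ ⁅ f ⁆`; each element other than `f` thus comes with its basis swap.
  module FundamentalCircuit {B f} (b : Feasible M B) (f∈E : f ∈ ground D) (f∉B : f ∉ B) where

    Replaceable : Pred (Fin n) 0ℓ
    Replaceable e = e ∈ B × Feasible M ((B - e) ∪ ⁅ f ⁆)

    replaceable? : Decidable Replaceable
    replaceable? e = (e ∈? B) ×-dec feasible? M ((B - e) ∪ ⁅ f ⁆)

    rest : Subset n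
    rest = comprehension replaceable?

    rest⁻ : ∀ {e} → e ∈ rest → Replaceable e
    rest⁻ = ∈-comprehension⁻ replaceable?

    C : Subset n
    C = rest ∪ ⁅ f ⁆

    f∈C : f ∈ C
    f∈C = q⊆p∪q rest ⁅ f ⁆ (x∈⁅x⁆ f)

    C⁻ : ∀ {x} → x ∈ C → x ≢ f → Replaceable x
    C⁻ x∈C x≢f = [ rest⁻ , (λ x∈f → contradiction (x∈⁅y⁆⇒x≡y f x∈f) x≢f) ]′ (x∈p∪q⁻ rest ⁅ f ⁆ x∈C)

    C⊆B∪f : C ⊆ B ∪ ⁅ f ⁆
    C⊆B∪f x∈C = [ p⊆p∪q ⁅ f ⁆ ∘ proj₁ ∘ rest⁻ , q⊆p∪q B ⁅ f ⁆ ]′ (x∈p∪q⁻ rest ⁅ f ⁆ x∈C)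

    -- A basis containing `C` could be chosen inside `B ∪ ⁅ f ⁆`. It would miss some `e ∈ B` and, by
    -- its size, equal `(B - e) ∪ ⁅ f ⁆`; but then `e` is replaceable and belongs to `C`.
    dependent : ¬ Independent M C
    dependent (B₁ , b₁ , C⊆B₁) =
      let B₂ , b₂ , C⊆B₂ , B₂⊆ = minimum-extend {D = D} isΔ b₁ (proj₁ b) C⊆B₁ C⊆B∪f (p⊆p∪q ⁅ f ⁆)
          e , e∈ = p⊈q⇒Nonempty[p─q] B B₂ λ B⊆B₂ →
            <⇒≢ (p⊂q⇒∣p∣<∣q∣ (B⊆B₂ , f , C⊆B₂ f∈C , f∉B)) (minimum-∣∣ {D = D} b b₂)
          e∈B , e∉B₂ = x∈p─q⁻ B B₂ e∈
          B₂⊆B-e∪f : B₂ ⊆ (B - e) ∪ ⁅ f ⁆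
          B₂⊆B-e∪f x∈ = x∈p∪q⁺ ([ (λ x∈B → inj₁ (x∈p∧x≢y⇒x∈p-y x∈B λ { refl → e∉B₂ x∈ })) , inj₂ ]′
                                  (x∈p∪q⁻ B ⁅ f ⁆ (B₂⊆ x∈)))
          B₂≡ = p⊆q∧∣q∣≤∣p∣⇒p≡q B₂⊆B-e∪f
            (≤-trans (∣p-u∪⁅v⁆∣≤∣p∣ e∈B) (≤-reflexive (minimum-∣∣ {D = D} b b₂)))
      in e∉B₂ (C⊆B₂ (p⊆p∪q ⁅ f ⁆ (∈-comprehension⁺ replaceable? (e∈B , subst (Feasible M) B₂≡ b₂))))

    circuit : Circuit M C
    circuit = C⊆E , dependent , proper
      where
      C⊆E : C ⊆ ground D
      C⊆E x∈C = [ feasible⊆ground M b , (λ x∈f → subst (_∈ ground D) (sym (x∈⁅y⁆⇒x≡y f x∈f)) f∈E) ]′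
                  (x∈p∪q⁻ B ⁅ f ⁆ (C⊆B∪f x∈C))
      proper : ∀ {X} → X ⊂ C → Independent M X
      -- If the missing element is `f`, the rest lies in `B`; otherwise `e` is replaceable and the
      -- swapped basis contains `X`.
      proper {X} (X⊆C , e , e∈C , e∉X) with e ≟ f
      ... | yes refl = B , b , λ x∈X → proj₁ (C⁻ (X⊆C x∈X) λ { refl → e∉X x∈X })
      ... | no e≢f = _ , proj₂ (C⁻ e∈C e≢f) , λ x∈X →
        x∈p∪q⁺ ([ (λ x∈B → inj₁ (x∈p∧x≢y⇒x∈p-y x∈B λ { refl → e∉X x∈X })) , inj₂ ]′
                  (x∈p∪q⁻ B ⁅ f ⁆ (C⊆B∪f (X⊆C x∈X))))

  -- Replacing an element e of B by f ∈ B′ ─ B, where e and f lie on a common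
  -- circuit, moves B towards B′ without changing ∣ B ∩ A ∣.
  separator⇒constant : ∀ {A} → Separator M A → ConstantOn A
  separator⇒constant {A} sep x y = ≤-antisym (go x y (<-wellFounded _)) (go y x (<-wellFounded _))
    where
    go : ∀ {B′ B} → Feasible M B′ → Feasible M B → Acc _<_ ∣ B′ ─ B ∣ → ∣ B′ ∩ A ∣ ≤ ∣ B ∩ A ∣
    go {B′} {B} b′ b (acc rec) with B′ ⊆? B
    ... | yes B′⊆B = p⊆q⇒∣p∣≤∣q∣ (∩-monoˡ-⊆ A B′⊆B)
    ... | no B′⊈B = swap-in (p⊈q⇒Nonempty[p─q] B′ B B′⊈B)
      where
      swap-in : Nonempty (B′ ─ B) → ∣ B′ ∩ A ∣ ≤ ∣ B ∩ A ∣
      swap-in (f , f∈) =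
        let f∈B′ , f∉B = x∈p─q⁻ B′ B f∈
            f∈E = feasible⊆ground M b′ f∈B′
            open FundamentalCircuit b f∈E f∉B
        in swap-out f∈B′ f∉B circuit f∈C (λ C⊆B′ → dependent (B′ , b′ , C⊆B′)) C⁻
        where
        swap-out : ∀ {C} → f ∈ B′ → f ∉ B → Circuit M C → f ∈ C → C ⊈ B′ →
                   (∀ {e} → e ∈ C → e ≢ f → e ∈ B × Feasible M ((B - e) ∪ ⁅ f ⁆)) →
                   ∣ B′ ∩ A ∣ ≤ ∣ B ∩ A ∣
        swap-out {C} f∈B′ f∉B circuit f∈C C⊈B′ C⁻ =
          -- The circuit is not contained in the basis `B′`, and its elements other than `f` lie in
          -- `B`; so some `e ∈ B ─ B′` can make room for `f`.
          let e , e∈ = p⊈q⇒Nonempty[p─q] C B′ C⊈B′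
              e∈C , e∉B′ = x∈p─q⁻ C B′ e∈
              e∈B , b″ = C⁻ e∈C λ { refl → e∉B′ f∈B′ }
          in ≤-trans (go b′ b″ (rec (∣q─[p-e∪⁅f⁆]∣<∣q─p∣ f∈B′ f∉B e∉B′)))
                     (∣[p-e∪⁅f⁆]∩q∣≤∣p∩q∣ e∈B λ f∈A → Equivalence.from (sep e)
                       (f , f∈A , feasible⊆ground M b′ f∈B′ , feasible⊆ground M b e∈B
                          , inj₂ (C , circuit , f∈C , e∈C)))

-- Iterated deletion, described by feasible sets with a minimal trace on the deleted set.

infix 4 _⊆[_]_
_⊆[_]_ : Subset n → Subset n → Subset n → Set
p ⊆[ r ] q = ∀ {x} → x ∈ r → x ∈ p → x ∈ q

-- By base-minimal, the condition F ⊆[ T ] base says that F and base agree on T.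
record Deletion (D : SetSystem n) (T : Subset n) (D′ : SetSystem n) : Set where
  field
    base          : Subset n
    base-feasible : Feasible D base
    base-minimal  : ∀ {F} → Feasible D F → F ⊆[ T ] base → base ⊆[ T ] F
    feasible⁺     : ∀ {F} → Feasible D F → F ⊆[ T ] base → Feasible D′ (F ─ T)
    feasible⁻     : ∀ {X} → Feasible D′ X → ∃[ F ] (Feasible D F × F ⊆[ T ] base × X ≡ F ─ T)

-- Supplies each branch of `delete` with the proof or refutation that `does` discards.
if-dec : ∀ {a} {B : Set a} {Q : Set} (P : B → Set) (Q? : Dec Q) {x y : B} →
         (Q → P x) → (¬ Q → P y) → P (if does Q? then x else y)
if-dec P (yes q) px py = px q
if-dec P (no ¬q) px py = py ¬q

deletion-⊥ : IsDeltaMatroid D → Deletion D ⊥ D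
deletion-⊥ {D = D} isΔ = record
  { base          = proj₁ (nonempty isΔ)
  ; base-feasible = proj₂ (nonempty isΔ)
  ; base-minimal  = λ _ _ x∈⊥ _ → contradiction x∈⊥ ∉⊥
  ; feasible⁺     = λ {F} f _ → subst (Feasible D) (sym (p─⊥≡p F)) f
  ; feasible⁻     = λ {X} f → X , f , (λ x∈⊥ _ → contradiction x∈⊥ ∉⊥) , sym (p─⊥≡p X)
  }

¬coloop⇒∃ : ∀ {e} → ¬ Coloop D e → ∃[ F ] (Feasible D F × e ∉ F)
¬coloop⇒∃ {D = D} {e} ¬coloop =
  decidable-stable (anySubset? λ F → feasible? D F ×-dec ¬? (e ∈? F)) λ none →
    ¬coloop λ {F} f → decidable-stable (e ∈? F) λ e∉F → none (F , f , e∉F)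

module _ {D D′ : SetSystem n} {T : Subset n} (deletion : Deletion D T D′) (e : Fin n) where

  open Deletion deletion

  private
    T′ = T ∪ ⁅ e ⁆

    T⊆T′ : T ⊆ T′
    T⊆T′ = p⊆p∪q ⁅ e ⁆

    e∈T′ : e ∈ T′
    e∈T′ = q⊆p∪q T ⁅ e ⁆ (x∈⁅x⁆ e)

    T′-elim : ∀ (P : Fin n → Set) → (∀ {x} → x ∈ T → P x) → P e → ∀ {x} → x ∈ T′ → P x
    T′-elim P on-T on-e x∈ with x∈p∪q⁻ T ⁅ e ⁆ x∈
    ... | inj₁ x∈T = on-T x∈T
    ... | inj₂ x∈e with refl ← x∈⁅y⁆⇒x≡y e x∈e = on-e

  -- Every feasible `F` below `base` on `T` contains the coloop `e`, and so does `base`; hence the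
  -- same base still works on `T ∪ ⁅ e ⁆`.
  deletion-coloop : Coloop D′ e → Deletion D T′ (contractNonLoop D′ e)
  deletion-coloop coloop = record
    { base          = base
    ; base-feasible = base-feasible
    ; base-minimal  = λ {F} f F⊆ → T′-elim (λ x → x ∈ base → x ∈ F)
        (base-minimal f (F⊆ ∘ T⊆T′)) λ _ → e∈ f (F⊆ ∘ T⊆T′)
    ; feasible⁺     = λ {F} f F⊆ →
        F ─ T , feasible⁺ f (F⊆ ∘ T⊆T′) , coloop (feasible⁺ f (F⊆ ∘ T⊆T′)) , sym (p─q─r≡p─q∪r F T ⁅ e ⁆)
    ; feasible⁻     = λ { (F′ , f′ , _ , refl) → from f′ }
    }
    where
    e∈ : ∀ {F} → Feasible D F → F ⊆[ T ] base → e ∈ F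
    e∈ {F} f F⊆ = p─q⊆p F T (coloop (feasible⁺ f F⊆))
    from : ∀ {F′} → Feasible D′ F′ → ∃[ F ] (Feasible D F × F ⊆[ T′ ] base × F′ - e ≡ F ─ T′)
    from f′ with F , f , F⊆ , refl ← feasible⁻ f′ =
      F , f , T′-elim (λ x → x ∈ F → x ∈ base) F⊆ (λ _ → e∈ base-feasible λ _ x∈ → x∈)
        , p─q─r≡p─q∪r F T ⁅ e ⁆

  -- The new base is a feasible `F₀` with `e ∉ F₀ ─ T`. It agrees with the old one on `T`, so lying
  -- below it adds only the condition `e ∉ F ─ T`.
  deletion-nonColoop : ¬ Coloop D′ e → Deletion D T′ (deleteNonColoop D′ e)
  deletion-nonColoop ¬coloop with F₀′ , f₀′ , e∉F₀′ ← ¬coloop⇒∃ {D = D′} ¬coloop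
                             with F₀ , f₀ , F₀⊆ , refl ← feasible⁻ f₀′ = record
    { base          = F₀
    ; base-feasible = f₀
    ; base-minimal  = λ {F} f F⊆ →
        let F₀⊆F : F₀ ⊆[ T ] F
            F₀⊆F x∈T x∈F₀ = base-minimal f (λ x∈T x∈F → F₀⊆ x∈T (F⊆ (T⊆T′ x∈T) x∈F)) x∈T (F₀⊆ x∈T x∈F₀)
        in T′-elim (λ x → x ∈ F₀ → x ∈ F) F₀⊆F λ e∈F₀ → F₀⊆F (e∈⇒e∈T e∈F₀ e∉F₀′) e∈F₀
    ; feasible⁺     = to
    ; feasible⁻     = from
    }
    where
    -- This covers the case that `e` already lies in `T`, where agreement on `T` decides membership.
    e∈⇒e∈T : ∀ {F} → e ∈ F → e ∉ F ─ T → e ∈ T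
    e∈⇒e∈T e∈F e∉ = decidable-stable (e ∈? T) λ e∉T → e∉ (x∈p∧x∉q⇒x∈p─q e∈F e∉T)

    ─T′ : ∀ F → e ∉ F ─ T → F ─ T ≡ F ─ T′
    ─T′ F e∉ = ⊆-antisym
      (λ x∈ → x∈p∧x∉q⇒x∈p─q (p─q⊆p F T x∈)
        λ x∈T′ → T′-elim (λ x → x ∉ F ─ T) (λ x∈T x∈ → x∈p─q⇒x∉q F T x∈ x∈T) e∉ x∈T′ x∈)
      λ x∈ → x∈p∧x∉q⇒x∈p─q (p─q⊆p F T′ x∈) (x∈p─q⇒x∉q F T′ x∈ ∘ T⊆T′)

    to : ∀ {F} → Feasible D F → F ⊆[ T′ ] F₀ → Feasible (deleteNonColoop D′ e) (F ─ T′)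
    to {F} f F⊆ = subst (Feasible (deleteNonColoop D′ e)) (─T′ F e∉)
      (f′ , λ x∈ → x∈p∧x≢y⇒x∈p-y (feasible⊆ground D′ f′ x∈) λ { refl → e∉ x∈ })
      where
      f′ = feasible⁺ f λ x∈T x∈F → F₀⊆ x∈T (F⊆ (T⊆T′ x∈T) x∈F)
      e∉ : e ∉ F ─ T
      e∉ e∈ with e∈F , e∉T ← x∈p─q⁻ F T e∈ = e∉F₀′ (x∈p∧x∉q⇒x∈p─q (F⊆ e∈T′ e∈F) e∉T)

    from : ∀ {X} → Feasible (deleteNonColoop D′ e) X →
           ∃[ F ] (Feasible D F × F ⊆[ T′ ] F₀ × X ≡ F ─ T′)
    from (f′ , X⊆E-e) with F , f , F⊆ , refl ← feasible⁻ f′ =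
      F , f , T′-elim (λ x → x ∈ F → x ∈ F₀) F⊆F₀ (λ e∈F → F⊆F₀ (e∈⇒e∈T e∈F e∉) e∈F) , ─T′ F e∉
      where
      e∉ : e ∉ F ─ T
      e∉ e∈ = proj₂ (x∈p-y⁻ (ground D′) e (X⊆E-e e∈)) refl
      F⊆F₀ : F ⊆[ T ] F₀
      F⊆F₀ x∈T x∈F = base-minimal f₀ F₀⊆ x∈T (F⊆ x∈T x∈F)

  deletion-delete : Deletion D T′ (delete D′ e)
  deletion-delete = if-dec (Deletion D T′) (coloop? D′ e) deletion-coloop deletion-nonColoop

deletion-foldl : ∀ es → Deletion D T D′ →
                 Deletion D (foldl (λ T e → T ∪ ⁅ e ⁆) T es) (foldl delete D′ es)
deletion-foldl []       deletion = deletion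
deletion-foldl (e ∷ es) deletion = deletion-foldl es (deletion-delete deletion e)

∈-foldl-∪⁻ : ∀ es → x ∈ foldl (λ T e → T ∪ ⁅ e ⁆) T es → x ∈ T ⊎ x ∈ₗ es
∈-foldl-∪⁻ []               x∈ = inj₁ x∈
∈-foldl-∪⁻ {T = T} (e ∷ es) x∈ with ∈-foldl-∪⁻ es x∈
... | inj₂ x∈es = inj₂ (there x∈es)
... | inj₁ x∈T∪e with x∈p∪q⁻ T ⁅ e ⁆ x∈T∪e
...   | inj₁ x∈T = inj₁ x∈T
...   | inj₂ x∈e = inj₂ (here (x∈⁅y⁆⇒x≡y e x∈e))

∈-foldl-∪⁺ : ∀ es → x ∈ T ⊎ x ∈ₗ es → x ∈ foldl (λ T e → T ∪ ⁅ e ⁆) T es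
∈-foldl-∪⁺ []       (inj₁ x∈T)          = x∈T
∈-foldl-∪⁺ (e ∷ es) (inj₁ x∈T)          = ∈-foldl-∪⁺ es (inj₁ (p⊆p∪q ⁅ e ⁆ x∈T))
∈-foldl-∪⁺ {T = T} (e ∷ es) (inj₂ (here refl)) = ∈-foldl-∪⁺ es (inj₁ (q⊆p∪q T ⁅ e ⁆ (x∈⁅x⁆ e)))
∈-foldl-∪⁺ (e ∷ es) (inj₂ (there x∈es)) = ∈-foldl-∪⁺ es (inj₂ x∈es)

deletion-restrict : ∀ {D : SetSystem n} → IsDeltaMatroid D → ∀ A → Deletion D (ground D ─ A) (restrict D A)
deletion-restrict {n = n} {D = D} isΔ A =
  subst (λ T → Deletion D T (restrict D A)) deleted (deletion-foldl es (deletion-⊥ isΔ))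
  where
  es = filter (_∈? (ground D ─ A)) (allFin n)
  deleted : foldl (λ T e → T ∪ ⁅ e ⁆) ⊥ es ≡ ground D ─ A
  deleted = ⊆-antisym
    (λ x∈ → [ (λ x∈⊥ → contradiction x∈⊥ ∉⊥) , (λ x∈es → proj₂ (∈-filter⁻ (_∈? (ground D ─ A)) {xs = allFin n} x∈es)) ]′
              (∈-foldl-∪⁻ es x∈))
    λ {x} x∈ → ∈-foldl-∪⁺ es (inj₂ (∈-filter⁺ (_∈? (ground D ─ A)) (∈-allFin x) x∈))

-- Two feasible sets that agree on `T` differ only outside `T`. An exchange between them therefore
-- moves only elements outside `T`, and its result still agrees with `base`.
deletion-isDeltaMatroid : IsDeltaMatroid D → Deletion D T D′ → IsDeltaMatroid D′
deletion-isDeltaMatroid {D = D} {T = T} {D′ = D′} isΔ deletion = record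
  { nonempty = _ , feasible⁺ base-feasible (λ _ x∈ → x∈)
  ; exchange = λ x y → exchange′ (feasible⁻ x) (feasible⁻ y)
  }
  where
  open Deletion deletion
  exchange′ : ∀ {X Y} → ∃[ F ] (Feasible D F × F ⊆[ T ] base × X ≡ F ─ T) →
              ∃[ F ] (Feasible D F × F ⊆[ T ] base × Y ≡ F ─ T) →
              ∀ {u} → u ∈ X △ Y → ∃[ v ] (v ∈ X △ Y × Feasible D′ (X △ (⁅ u ⁆ ∪ ⁅ v ⁆)))
  exchange′ (F , f , F⊆ , refl) (H , h , H⊆ , refl) {u} u∈
    with u∈F△H , u∉T ← x∈p─q⁻ (F △ H) T (subst (u ∈_) (sym (△-distribʳ-─ F H T)) u∈)
    with v , v∈F△H , f′ ← exchange isΔ f h u∈F△H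
    = v , subst (v ∈_) (△-distribʳ-─ F H T) (x∈p∧x∉q⇒x∈p─q v∈F△H v∉T)
        , subst (Feasible D′) F△K─T (feasible⁺ f′ agrees)
    where
    K = ⁅ u ⁆ ∪ ⁅ v ⁆
    v∉T : v ∉ T
    v∉T v∈T with x∈p△q⁻ F H v∈F△H
    ... | inj₁ (v∈F , v∉H) = v∉H (base-minimal h H⊆ v∈T (F⊆ v∈T v∈F))
    ... | inj₂ (v∉F , v∈H) = v∉F (base-minimal f F⊆ v∈T (H⊆ v∈T v∈H))
    K∌T : ∀ {x} → x ∈ K → x ∉ T
    K∌T x∈K x∈T with x∈p∪q⁻ ⁅ u ⁆ ⁅ v ⁆ x∈K
    ... | inj₁ x∈u with refl ← x∈⁅y⁆⇒x≡y u x∈u = u∉T x∈T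
    ... | inj₂ x∈v with refl ← x∈⁅y⁆⇒x≡y v x∈v = v∉T x∈T
    K─T≡K : K ─ T ≡ K
    K─T≡K = ⊆-antisym (p─q⊆p K T) λ x∈K → x∈p∧x∉q⇒x∈p─q x∈K (K∌T x∈K)
    F△K─T : (F △ K) ─ T ≡ (F ─ T) △ K
    F△K─T = trans (△-distribʳ-─ F K T) (cong ((F ─ T) △_) K─T≡K)
    agrees : F △ K ⊆[ T ] base
    agrees x∈T x∈ with x∈p△q⁻ F K x∈
    ... | inj₁ (x∈F , _) = F⊆ x∈T x∈F
    ... | inj₂ (_ , x∈K) = contradiction x∈T (K∌T x∈K)

-- Growing against `base` shows that the largest size in the twist by `T` is attained on the sets
-- that give `D′`.
∈-deletion-grow : IsDeltaMatroid D → (d : Deletion D T D′) → Feasible D X →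
  ∃[ F ] (Feasible D F × F ⊆[ T ] Deletion.base d × ∣ T △ X ∣ ≤ ∣ T △ F ∣)
∈-deletion-grow {T = T} isΔ d x with F , f , F∩T⊆ , le ← grow-△ isΔ T (Deletion.base-feasible d) x =
  F , f , (λ x∈T x∈F → F∩T⊆ (x∈p∩q⁺ (x∈F , x∈T))) , le

-- A set of minimum size is exchanged into `base ∪ ∁ T`, with the empty set as the part to keep.
∈-deletion-minimum : IsDeltaMatroid D → (d : Deletion D T D′) →
  ∃[ F ] (Feasible (minimum D) F × F ⊆[ T ] Deletion.base d)
∈-deletion-minimum {D = D} {T = T} isΔ d =
  let open Deletion d
      F , f , _ , F⊆ = minimum-extend {D = D} {S = base ∪ ∁ T} isΔ (proj₂ (minimum-nonempty isΔ))
                         base-feasible (⊆-min _) (⊆-min _) (p⊆p∪q (∁ T))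
  in F , f , λ x∈T x∈F → [ (λ x∈base → x∈base) , (λ x∈∁T → contradiction x∈T (x∈∁p⇒x∉p x∈∁T)) ]′
                           (x∈p∪q⁻ base (∁ T) (F⊆ x∈F))

deletion-∩ : (d : Deletion D T D′) → Feasible D X → X ⊆[ T ] Deletion.base d →
             Feasible D Y → Y ⊆[ T ] Deletion.base d → X ∩ T ≡ Y ∩ T
deletion-∩ {D = D} {T = T} d x X⊆ y Y⊆ = ⊆-antisym (sub X⊆ y Y⊆) (sub Y⊆ x X⊆)
  where
  open Deletion d
  sub : ∀ {X Y} → X ⊆[ T ] base → Feasible D Y → Y ⊆[ T ] base → X ∩ T ⊆ Y ∩ T
  sub {X} X⊆ y Y⊆ x∈ with x∈X , x∈T ← x∈p∩q⁻ X T x∈ =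
    x∈p∩q⁺ (base-minimal y Y⊆ x∈T (X⊆ x∈T x∈X) , x∈T)

-- If `a` were smaller than `a₀`, the equation would push `t` at least two above `t₀`.
t+2a≡⇒a≤ : ∀ {t₀ t a₀ a} → t₀ + (a₀ + a₀) ≡ t + (a + a) → t ≤ suc t₀ → a₀ ≤ a
t+2a≡⇒a≤ {t₀} {t} {a₀} {a} eq t≤ = ≮⇒≥ λ a<a₀ → <-irrefl (sym eq) (begin-strict
  t + (a + a)             ≤⟨ +-monoˡ-≤ (a + a) t≤ ⟩
  suc t₀ + (a + a)        <⟨ n<1+n _ ⟩
  suc (suc t₀ + (a + a))  ≡⟨ shuffle t₀ a ⟩
  t₀ + (suc a + suc a)    ≤⟨ +-monoʳ-≤ t₀ (+-mono-≤ a<a₀ a<a₀) ⟩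
  t₀ + (a₀ + a₀)          ∎)
  where
  open ≤-Reasoning
  shuffle : ∀ t a → suc (suc t + (a + a)) ≡ t + (suc a + suc a)
  shuffle = solve-∀

-- A nonzero truncated difference is a true difference.
1≡m∸n⇒m≡1+n : ∀ {m n} → 1 ≡ m ∸ n → m ≡ suc n
1≡m∸n⇒m≡1+n {m} {n} eq = trans (sym (m∸n+n≡m n≤m)) (cong (_+ n) (sym eq))
  where
  n≤m : n ≤ m
  n≤m = <⇒≤ (m∸n≢0⇒n<m λ m∸n≡0 → 1+n≢0 (trans eq m∸n≡0))

-- Sizes in `D | A` and `D | (E ─ A)` against sizes in the twist by `A`.

module Sides (D : SetSystem n) (isΔ : IsDeltaMatroid D) {A : Subset n} (A⊆E : A ⊆ ground D) where

  private
    E = ground D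
    M = minimum D

  size : ∀ F → ∣ A △ F ∣ + ∣ F ∩ A ∣ ≡ ∣ A ∣ + ∣ F ─ A ∣
  size = ∣p△q∣+∣q∩p∣≡∣p∣+∣q─p∣ A

  complement-size : ∀ {F} → Feasible D F → ∣ (E ─ A) △ F ∣ + ∣ A △ F ∣ ≡ ∣ E ∣
  complement-size f = ∣[E─A]△F∣+∣A△F∣≡∣E∣ A⊆E (feasible⊆ground D f)

  inner : Deletion D (E ─ A) (restrict D A)
  inner = deletion-restrict isΔ A

  outer : Deletion D A (restrict D (E ─ A))
  outer = subst (λ T → Deletion D T (restrict D (E ─ A))) (E─[E─A]≡A A⊆E) (deletion-restrict isΔ (E ─ A))

  open Deletion inner using () renaming (base to I₀; feasible⁺ to inner⁺; feasible⁻ to inner⁻)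
  open Deletion outer using () renaming (base to O₀; feasible⁺ to outer⁺; feasible⁻ to outer⁻)

  -- The feasible sets whose traces on `A` form `D | A`; `I₀` fixes their trace on `E ─ A`. `Outer`
  -- is the counterpart for `D | (E ─ A)`.
  Inner : Subset n → Set
  Inner F = Feasible D F × F ⊆[ E ─ A ] I₀

  Outer : Subset n → Set
  Outer F = Feasible D F × F ⊆[ A ] O₀

  restrict-inner⁺ : ∀ {F} → Inner F → Feasible (restrict D A) (F ∩ A)
  restrict-inner⁺ (f , F⊆) =
    subst (Feasible (restrict D A)) (p─[E─A]≡p∩A A (feasible⊆ground D f)) (inner⁺ f F⊆)

  restrict-inner⁻ : ∀ {X} → Feasible (restrict D A) X → ∃[ F ] (Inner F × X ≡ F ∩ A)
  restrict-inner⁻ x with F , f , F⊆ , X≡ ← inner⁻ x =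
    F , (f , F⊆) , trans X≡ (p─[E─A]≡p∩A A (feasible⊆ground D f))

  restrict-outer⁺ : ∀ {F} → Outer F → Feasible (restrict D (E ─ A)) (F ─ A)
  restrict-outer⁺ (f , F⊆) = outer⁺ f F⊆

  restrict-outer⁻ : ∀ {X} → Feasible (restrict D (E ─ A)) X → ∃[ F ] (Outer F × X ≡ F ─ A)
  restrict-outer⁻ x with F , f , F⊆ , X≡ ← outer⁻ x = F , (f , F⊆) , X≡

  inner-─ : ∀ {F G} → Inner F → Inner G → ∣ F ─ A ∣ ≡ ∣ G ─ A ∣
  inner-─ (f , F⊆) (g , G⊆) = cong ∣_∣ (trans (sym (p∩[E─A]≡p─A A (feasible⊆ground D f)))
    (trans (deletion-∩ inner f F⊆ g G⊆) (p∩[E─A]≡p─A A (feasible⊆ground D g))))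

  outer-∩ : ∀ {F G} → Outer F → Outer G → ∣ F ∩ A ∣ ≡ ∣ G ∩ A ∣
  outer-∩ (f , F⊆) (g , G⊆) = cong ∣_∣ (deletion-∩ outer f F⊆ g G⊆)

  -- Growing in the twist by `E ─ A` means shrinking in the twist by `A`, as the two sizes add up to
  -- `∣ E ∣`.
  inner-below : ∀ {F} → Feasible D F → ∃[ F′ ] (Inner F′ × ∣ A △ F′ ∣ ≤ ∣ A △ F ∣)
  inner-below {F} f with F′ , f′ , F′⊆ , le ← ∈-deletion-grow isΔ inner f =
    F′ , (f′ , F′⊆) , +-cancelˡ-≤ ∣ (E ─ A) △ F ∣ _ _ (≤-trans (+-monoˡ-≤ _ le)
      (≤-reflexive (trans (complement-size f′) (sym (complement-size f)))))

  outer-above : ∀ {F} → Feasible D F → ∃[ F′ ] (Outer F′ × ∣ A △ F ∣ ≤ ∣ A △ F′ ∣)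
  outer-above f with F′ , f′ , F′⊆ , le ← ∈-deletion-grow isΔ outer f = F′ , (f′ , F′⊆) , le

  module _ (const : ConstantOn D isΔ A) {X₀} (x₀ : Feasible M X₀) where

    minimum-─ : ∀ {X} → Feasible M X → ∣ X ─ A ∣ ≡ ∣ X₀ ─ A ∣
    minimum-─ {X} x = +-cancelˡ-≡ ∣ X ∩ A ∣ _ _ (begin
      ∣ X ∩ A ∣ + ∣ X ─ A ∣    ≡⟨ ∣p∩q∣+∣p─q∣≡∣p∣ X A ⟩
      ∣ X ∣                    ≡⟨ minimum-∣∣ {D = D} x x₀ ⟩
      ∣ X₀ ∣                   ≡⟨ ∣p∩q∣+∣p─q∣≡∣p∣ X₀ A ⟨
      ∣ X₀ ∩ A ∣ + ∣ X₀ ─ A ∣  ≡⟨ cong (_+ _) (const x₀ x) ⟩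
      ∣ X ∩ A ∣ + ∣ X₀ ─ A ∣   ∎)
      where open ≡-Reasoning

    -- Both `Inner` and `Outer` contain sets of minimum size. These all have the same sizes on `A`
    -- and off `A`, so `X₀` serves as the reference for both sides.
    inner-minimum : ∃[ X ] (Inner X × ∣ X ∩ A ∣ ≡ ∣ X₀ ∩ A ∣)
    inner-minimum with X , x , X⊆ ← ∈-deletion-minimum isΔ inner = X , (proj₁ x , X⊆) , const x x₀

    outer-minimum : ∃[ X ] (Outer X × ∣ X ─ A ∣ ≡ ∣ X₀ ─ A ∣)
    outer-minimum with X , x , X⊆ ← ∈-deletion-minimum isΔ outer = X , (proj₁ x , X⊆) , minimum-─ x

    inner-─₀ : ∀ {F} → Inner F → ∣ F ─ A ∣ ≡ ∣ X₀ ─ A ∣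
    inner-─₀ i with X , x , X⊆ ← ∈-deletion-minimum isΔ inner =
      trans (inner-─ i (proj₁ x , X⊆)) (minimum-─ x)

    outer-∩₀ : ∀ {F} → Outer F → ∣ F ∩ A ∣ ≡ ∣ X₀ ∩ A ∣
    outer-∩₀ o with X , x , X⊆ ← ∈-deletion-minimum isΔ outer =
      trans (outer-∩ o (proj₁ x , X⊆)) (const x x₀)

    ∣X₀∣≤ : ∀ {F} → Feasible D F → ∣ X₀ ∩ A ∣ + ∣ X₀ ─ A ∣ ≤ ∣ F ∩ A ∣ + ∣ F ─ A ∣
    ∣X₀∣≤ {F} f = subst₂ _≤_ (sym (∣p∩q∣+∣p─q∣≡∣p∣ X₀ A)) (sym (∣p∩q∣+∣p─q∣≡∣p∣ F A)) (proj₂ x₀ f)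

    inner-∩-≥ : ∀ {F} → Inner F → ∣ X₀ ∩ A ∣ ≤ ∣ F ∩ A ∣
    inner-∩-≥ {F} i = +-cancelʳ-≤ ∣ X₀ ─ A ∣ _ _
      (subst (λ k → ∣ X₀ ∩ A ∣ + ∣ X₀ ─ A ∣ ≤ ∣ F ∩ A ∣ + k) (inner-─₀ i) (∣X₀∣≤ (proj₁ i)))

    outer-─-≥ : ∀ {F} → Outer F → ∣ X₀ ─ A ∣ ≤ ∣ F ─ A ∣
    outer-─-≥ {F} o = +-cancelˡ-≤ ∣ X₀ ∩ A ∣ _ _
      (subst (λ k → ∣ X₀ ∩ A ∣ + ∣ X₀ ─ A ∣ ≤ k + ∣ F ─ A ∣) (outer-∩₀ o) (∣X₀∣≤ (proj₁ o)))

    -- With `∣ F ─ A ∣` fixed, the twisted size falls as `∣ F ∩ A ∣` rises; in `outer-size` it rises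
    -- with `∣ F ─ A ∣`.
    inner-size : ∀ {F} → Inner F → ∣ A △ F ∣ + ∣ F ∩ A ∣ ≡ ∣ A △ X₀ ∣ + ∣ X₀ ∩ A ∣
    inner-size {F} i = trans (size F) (trans (cong (∣ A ∣ +_) (inner-─₀ i)) (sym (size X₀)))

    outer-size : ∀ {F} → Outer F → ∣ A △ F ∣ + ∣ X₀ ─ A ∣ ≡ ∣ A △ X₀ ∣ + ∣ F ─ A ∣
    outer-size {F} o = +-cancelʳ-≡ (∣ X₀ ∩ A ∣ + ∣ A ∣) _ _ (begin
      ∣ A △ F ∣ + ∣ X₀ ─ A ∣ + (∣ X₀ ∩ A ∣ + ∣ A ∣)        ≡⟨ shuffle₁ ∣ A △ F ∣ _ _ _ ⟩
      (∣ A △ F ∣ + ∣ X₀ ∩ A ∣) + (∣ A ∣ + ∣ X₀ ─ A ∣)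
        ≡⟨ cong₂ _+_ (cong (∣ A △ F ∣ +_) (sym (outer-∩₀ o))) (sym (size X₀)) ⟩
      (∣ A △ F ∣ + ∣ F ∩ A ∣) + (∣ A △ X₀ ∣ + ∣ X₀ ∩ A ∣)
        ≡⟨ cong (_+ (∣ A △ X₀ ∣ + ∣ X₀ ∩ A ∣)) (size F) ⟩
      (∣ A ∣ + ∣ F ─ A ∣) + (∣ A △ X₀ ∣ + ∣ X₀ ∩ A ∣)      ≡⟨ shuffle₂ (∣ A ∣) _ ∣ A △ X₀ ∣ _ ⟩
      ∣ A △ X₀ ∣ + ∣ F ─ A ∣ + (∣ X₀ ∩ A ∣ + ∣ A ∣)        ∎)
      where
      open ≡-Reasoning
      shuffle₁ : ∀ t b a c → t + b + (a + c) ≡ (t + a) + (c + b)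
      shuffle₁ = solve-∀
      shuffle₂ : ∀ c b t a → (c + b) + (t + a) ≡ t + b + (a + c)
      shuffle₂ = solve-∀

    -- Equicardinality of `D | A` gives all inner sets the twisted size of `X₀`, which is therefore
    -- the minimum. The maximum is attained by the outer set `F*` with the largest trace on `E ─ A`.
    twist-width-one : IsMatroid (restrict D A) → HasWidth (restrict D (E ─ A)) 1 →
                      HasWidth (twist D A A⊆E) 1
    twist-width-one matroid (w , b , ((_ , z , ∣Z∣≡w) , ≤w) , ((_ , y , ∣Y∣≡b) , b≤) , 1≡w∸b) =
      extremes (restrict-outer⁻ z) ∣Z∣≡w (restrict-outer⁻ y) ∣Y∣≡b
      where
      lower : ∀ {F} → Feasible D F → ∣ A △ X₀ ∣ ≤ ∣ A △ F ∣
      lower f =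
        let F′ , i′ , le = inner-below f
            X , i , a≡ = inner-minimum
            t≡ = +-cancelʳ-≡ ∣ F′ ∩ A ∣ _ _ (trans (inner-size i′) (cong (∣ A △ X₀ ∣ +_)
                   (trans (sym a≡) (equicardinal matroid (restrict-inner⁺ i) (restrict-inner⁺ i′)))))
        in ≤-trans (≤-reflexive (sym t≡)) le

      extremes : ∀ {Z Y} → ∃[ F ] (Outer F × Z ≡ F ─ A) → ∣ Z ∣ ≡ w →
                 ∃[ H ] (Outer H × Y ≡ H ─ A) → ∣ Y ∣ ≡ b → HasWidth (twist D A A⊆E) 1
      extremes (F* , o* , refl) ∣F*∣≡w (H , h , refl) ∣H∣≡b =
        ∣ A △ F* ∣ , ∣ A △ X₀ ∣
        , ((A △ F* , (F* , proj₁ o* , refl) , refl) , λ { (F , f , refl) → upper f })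
        , ((A △ X₀ , (X₀ , proj₁ x₀ , refl) , refl) , λ { (F , f , refl) → lower f })
        , sym (trans (cong (_∸ ∣ A △ X₀ ∣) top) (m+n∸n≡m 1 ∣ A △ X₀ ∣))
        where
        -- The smallest size in `D | (E ─ A)` is attained by the trace of a set of `minimum D`.
        b≡ : b ≡ ∣ X₀ ─ A ∣
        b≡ = let X , o , eq = outer-minimum in ≤-antisym
          (≤-trans (b≤ (restrict-outer⁺ o)) (≤-reflexive eq))
          (≤-trans (outer-─-≥ h) (≤-reflexive ∣H∣≡b))

        top : ∣ A △ F* ∣ ≡ suc ∣ A △ X₀ ∣
        top = +-cancelʳ-≡ ∣ X₀ ─ A ∣ _ _ (begin
          ∣ A △ F* ∣ + ∣ X₀ ─ A ∣      ≡⟨ outer-size o* ⟩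
          ∣ A △ X₀ ∣ + ∣ F* ─ A ∣
            ≡⟨ cong (∣ A △ X₀ ∣ +_) (trans ∣F*∣≡w (trans (1≡m∸n⇒m≡1+n 1≡w∸b) (cong suc b≡))) ⟩
          ∣ A △ X₀ ∣ + suc ∣ X₀ ─ A ∣  ≡⟨ +-suc _ _ ⟩
          suc ∣ A △ X₀ ∣ + ∣ X₀ ─ A ∣  ∎)
          where open ≡-Reasoning

        upper : ∀ {F} → Feasible D F → ∣ A △ F ∣ ≤ ∣ A △ F* ∣
        upper f = let F′ , o′ , le = outer-above f in
          ≤-trans le (+-cancelʳ-≤ ∣ X₀ ─ A ∣ _ _ (begin
            ∣ A △ F′ ∣ + ∣ X₀ ─ A ∣  ≡⟨ outer-size o′ ⟩
            ∣ A △ X₀ ∣ + ∣ F′ ─ A ∣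
              ≤⟨ +-monoʳ-≤ _ (≤-trans (≤w (restrict-outer⁺ o′)) (≤-reflexive (sym ∣F*∣≡w))) ⟩
            ∣ A △ X₀ ∣ + ∣ F* ─ A ∣  ≡⟨ outer-size o* ⟨
            ∣ A △ F* ∣ + ∣ X₀ ─ A ∣  ∎))
          where open ≤-Reasoning

  -- Here `X₀`, of minimum size in `D`, also has minimum size in the twist; the opposite case is
  -- brought to this form by passing to the complementary twist.
  module _ {X₀ F*} (x₀ : Feasible M X₀) (f* : Feasible D F*)
           (lower : ∀ {F} → Feasible D F → ∣ A △ X₀ ∣ ≤ ∣ A △ F ∣)
           (upper : ∀ {F} → Feasible D F → ∣ A △ F ∣ ≤ ∣ A △ F* ∣)
           (top : ∣ A △ F* ∣ ≡ suc ∣ A △ X₀ ∣) where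

    -- Adding ∣ X ∩ A ∣ to ∣ A △ X ∣ + ∣ X ∩ A ∣ = ∣ A ∣ + ∣ X ─ A ∣ makes the right-hand
    -- side depend on ∣ X ∣ only, so ∣ A △ X ∣ has constant parity on minimum D.
    width-one⇒constant : ConstantOn D isΔ A
    width-one⇒constant x y = trans (const₀ x) (sym (const₀ y))
      where
      double : ∀ X → ∣ A △ X ∣ + (∣ X ∩ A ∣ + ∣ X ∩ A ∣) ≡ ∣ A ∣ + ∣ X ∣
      double X = begin
        ∣ A △ X ∣ + (∣ X ∩ A ∣ + ∣ X ∩ A ∣)  ≡⟨ +-assoc ∣ A △ X ∣ _ _ ⟨
        ∣ A △ X ∣ + ∣ X ∩ A ∣ + ∣ X ∩ A ∣    ≡⟨ cong (_+ ∣ X ∩ A ∣) (size X) ⟩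
        ∣ A ∣ + ∣ X ─ A ∣ + ∣ X ∩ A ∣        ≡⟨ +-assoc ∣ A ∣ _ _ ⟩
        ∣ A ∣ + (∣ X ─ A ∣ + ∣ X ∩ A ∣)
          ≡⟨ cong (∣ A ∣ +_) (trans (+-comm ∣ X ─ A ∣ _) (∣p∩q∣+∣p─q∣≡∣p∣ X A)) ⟩
        ∣ A ∣ + ∣ X ∣                        ∎
        where open ≡-Reasoning
      const₀ : ∀ {X} → Feasible M X → ∣ X ∩ A ∣ ≡ ∣ X₀ ∩ A ∣
      const₀ {X} x = ≤-antisym (t+2a≡⇒a≤ eq (m≤n⇒m≤1+n (lower (proj₁ x))))
        (t+2a≡⇒a≤ (sym eq) (≤-trans (upper (proj₁ x)) (≤-reflexive top)))
        where
        eq : ∣ A △ X ∣ + (∣ X ∩ A ∣ + ∣ X ∩ A ∣) ≡ ∣ A △ X₀ ∣ + (∣ X₀ ∩ A ∣ + ∣ X₀ ∩ A ∣)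
        eq = trans (double X) (trans (cong (∣ A ∣ +_) (minimum-∣∣ {D = D} x x₀)) (sym (double X₀)))

    private const = width-one⇒constant

    restrict-isMatroid : IsMatroid (restrict D A)
    restrict-isMatroid = record
      { isDeltaMatroid = deletion-isDeltaMatroid isΔ inner
      ; equicardinal   = λ x y → trans (∣∣≡ (restrict-inner⁻ x)) (sym (∣∣≡ (restrict-inner⁻ y)))
      }
      where
      -- Through `inner-size`, `lower` bounds `∣ F ∩ A ∣` from above; the minimality of `∣ X₀ ∣`
      -- bounds it from below.
      ∣∣≡ : ∀ {X} → ∃[ F ] (Inner F × X ≡ F ∩ A) → ∣ X ∣ ≡ ∣ X₀ ∩ A ∣
      ∣∣≡ (F , i , refl) = ≤-antisym
        (+-cancelˡ-≤ ∣ A △ X₀ ∣ _ _ (≤-trans (+-monoˡ-≤ _ (lower (proj₁ i)))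
          (≤-reflexive (inner-size const x₀ i))))
        (inner-∩-≥ const x₀ i)

    -- A set of minimum size gives the lower end. For the upper end, moving `F*` into `Outer` keeps
    -- the twisted size maximal, and `outer-size` converts it into a size off `A`.
    restrict-width-one : HasWidth (restrict D (E ─ A)) 1
    restrict-width-one =
      let F , o , le = outer-above f*
          X , p , eq = outer-minimum const x₀
      in suc ∣ X₀ ─ A ∣ , ∣ X₀ ─ A ∣
       , ((F ─ A , restrict-outer⁺ o , attained o le) , λ z → bound (restrict-outer⁻ z))
       , ((X ─ A , restrict-outer⁺ p , eq) , λ z → least (restrict-outer⁻ z))
       , sym (m+n∸n≡m 1 ∣ X₀ ─ A ∣)
      where
      bound : ∀ {Z} → ∃[ H ] (Outer H × Z ≡ H ─ A) → ∣ Z ∣ ≤ suc ∣ X₀ ─ A ∣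
      bound (H , h , refl) = +-cancelˡ-≤ ∣ A △ X₀ ∣ _ _ (begin
        ∣ A △ X₀ ∣ + ∣ H ─ A ∣       ≡⟨ outer-size const x₀ h ⟨
        ∣ A △ H ∣ + ∣ X₀ ─ A ∣       ≤⟨ +-monoˡ-≤ _ (≤-trans (upper (proj₁ h)) (≤-reflexive top)) ⟩
        suc ∣ A △ X₀ ∣ + ∣ X₀ ─ A ∣  ≡⟨ +-suc _ _ ⟨
        ∣ A △ X₀ ∣ + suc ∣ X₀ ─ A ∣  ∎)
        where open ≤-Reasoning
      least : ∀ {Z} → ∃[ H ] (Outer H × Z ≡ H ─ A) → ∣ X₀ ─ A ∣ ≤ ∣ Z ∣
      least (H , h , refl) = outer-─-≥ const x₀ h
      attained : ∀ {F} → Outer F → ∣ A △ F* ∣ ≤ ∣ A △ F ∣ → ∣ F ─ A ∣ ≡ suc ∣ X₀ ─ A ∣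
      attained {F} o le = ≤-antisym (bound (F , o , refl)) (+-cancelˡ-≤ ∣ A △ X₀ ∣ _ _ (begin
        ∣ A △ X₀ ∣ + suc ∣ X₀ ─ A ∣  ≡⟨ +-suc _ _ ⟩
        suc ∣ A △ X₀ ∣ + ∣ X₀ ─ A ∣  ≤⟨ +-monoˡ-≤ _ (≤-trans (≤-reflexive (sym top)) le) ⟩
        ∣ A △ F ∣ + ∣ X₀ ─ A ∣       ≡⟨ outer-size const x₀ o ⟩
        ∣ A △ X₀ ∣ + ∣ F ─ A ∣       ∎))
        where open ≤-Reasoning

    decomposition : ∃[ A ] (A ⊆ E × Separator M A × IsMatroid (restrict D A)
                            × HasWidth (restrict D (E ─ A)) 1)
    decomposition = A , A⊆E , constant⇒separator D isΔ A⊆E const , restrict-isMatroid , restrict-width-one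

-- The equivalence: choosing `B` from `A`, and `A` as `B` or `E ─ B`.

theorem1p1 : ∀ {n : ℕ} (D : SetSystem n) → IsDeltaMatroid D →
    (∃[ B ] Σ[ B⊆E ∈ B ⊆ SetSystem.ground D ] HasWidth (twist D B B⊆E) 1)
    ⇔
    (∃[ A ] (A ⊆ SetSystem.ground D
    × Separator (minimum D) A
    × IsMatroid (restrict D A)
    × HasWidth (restrict D (SetSystem.ground D ─ A)) 1))
theorem1p1 D isΔ = mk⇔ to from
  where
  E = ground D

  from : ∃[ A ] (A ⊆ E × Separator (minimum D) A × IsMatroid (restrict D A)
                 × HasWidth (restrict D (E ─ A)) 1) →
         ∃[ B ] Σ[ B⊆E ∈ B ⊆ E ] HasWidth (twist D B B⊆E) 1
  from (A , A⊆E , sep , matroid , width) = A , A⊆E ,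
    Sides.twist-width-one D isΔ A⊆E (separator⇒constant D isΔ sep) (proj₂ (minimum-nonempty isΔ))
      matroid width

  -- The sets of minimum D have twisted size k or k + 1. In the second case the
  -- twist by E ─ B, whose sizes are ∣ E ∣ minus those of the twist by B, exchanges
  -- the roles of the extremes.
  to : ∃[ B ] Σ[ B⊆E ∈ B ⊆ E ] HasWidth (twist D B B⊆E) 1 →
       ∃[ A ] (A ⊆ E × Separator (minimum D) A × IsMatroid (restrict D A)
               × HasWidth (restrict D (E ─ A)) 1)
  to (B , B⊆E , k′ , k , ((_ , (F′ , f′ , refl) , F′≡k′) , ≤k′) , ((_ , (F , f , refl) , F≡k) , k≤) , 1≡k′∸k)
    with X₀ , x₀ ← minimum-nonempty isΔ
    with ∣ B △ X₀ ∣ ≤? k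
  ... | yes X₀≤k = Sides.decomposition D isΔ B⊆E x₀ f′
    (λ h → ≤-trans X₀≤k (k≤ (_ , h , refl)))
    (λ h → ≤-trans (≤k′ (_ , h , refl)) (≤-reflexive (sym F′≡k′)))
    (trans F′≡k′ (trans (1≡m∸n⇒m≡1+n 1≡k′∸k)
      (cong suc (≤-antisym (k≤ (X₀ , proj₁ x₀ , refl)) X₀≤k))))
  ... | no X₀≰k = Sides.decomposition D isΔ (p─q⊆p E B) x₀ f
    (λ h → reflect (proj₁ x₀) h (≤-trans (≤k′ (_ , h , refl)) (≤-reflexive (sym X₀≡k′))))
    (λ h → reflect h f (≤-trans (≤-reflexive F≡k) (k≤ (_ , h , refl))))
    (+-cancelʳ-≡ ∣ B △ F ∣ _ _ (begin
      ∣ (E ─ B) △ F ∣ + ∣ B △ F ∣       ≡⟨ complement-size f ⟩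
      ∣ E ∣                             ≡⟨ complement-size (proj₁ x₀) ⟨
      ∣ (E ─ B) △ X₀ ∣ + ∣ B △ X₀ ∣
        ≡⟨ cong (∣ (E ─ B) △ X₀ ∣ +_) (trans X₀≡k′ (trans k′≡1+k (cong suc (sym F≡k)))) ⟩
      ∣ (E ─ B) △ X₀ ∣ + suc ∣ B △ F ∣  ≡⟨ +-suc _ _ ⟩
      suc ∣ (E ─ B) △ X₀ ∣ + ∣ B △ F ∣   ∎))
    where
    open ≡-Reasoning
    open Sides D isΔ B⊆E using (complement-size)
    k′≡1+k = 1≡m∸n⇒m≡1+n 1≡k′∸k
    -- Width one leaves `k′` as the only size above `k`.
    X₀≡k′ : ∣ B △ X₀ ∣ ≡ k′
    X₀≡k′ = ≤-antisym (≤k′ (X₀ , proj₁ x₀ , refl)) (≤-trans (≤-reflexive k′≡1+k) (≰⇒> X₀≰k))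
    reflect : ∀ {G H} → Feasible D G → Feasible D H → ∣ B △ H ∣ ≤ ∣ B △ G ∣ →
              ∣ (E ─ B) △ G ∣ ≤ ∣ (E ─ B) △ H ∣
    reflect {G} {H} g h le = +-cancelʳ-≤ ∣ B △ H ∣ _ _ (≤-trans (+-monoʳ-≤ _ le)
      (≤-reflexive (trans (complement-size g) (sym (complement-size h)))))
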